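{- Let $r\ge 1$ be an integer, let $\mathcal{B}$ be any board, and let $\mathbb{P}$ be a rider with $r$ basic moves, with move set $\mathbf{M}=\{m_1,\dots,m_r\}$. The number of unlabelled combinatorial types of nonattacking configurations of $3$ copies of $\mathbb{P}$ on dilations of $\mathcal{B}$ equals $$\tfrac13\, r\,(r^2+3r-1).$$ Moreover, the set of combinatorial types of nonattacking configurations of $3$ copies depends only on $r$ and, up to reorientation, is independent of the move set: if $\mathbf{M}$ and $\mathbf{M}'$ are any two move sets with $r$ basic moves, each indexed in increasing order of slope, and $\mathcal{B},\mathcal{B}'$ are any two boards, then the set of combinatorial types of three copies of the rider with move set $\mathbf{M}$ on dilations of $\mathcal{B}$ and the set of combinatorial types of three copies of the rider with move set $\mathbf{M}'$ on dilations of $\mathcal{B}'$ are equal up to reorientation.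
   Context: **Board.** A board $\mathcal{B}$ is a closed, bounded, convex polygonal region in $\mathbb{R}^2$ with nonempty interior $\mathcal{B}^\circ$. (Its vertices need not be rational.) The working board of order $n$ (for an integer $n\ge 1$) is $(n+1)\mathcal{B}^\circ\cap\mathbb{Z}^2$. "On dilations of the board" means that all orders $n$ are allowed. **Rider.** A rider $\mathbb{P}$ with $r$ basic moves is given by its move set $\mathbf{M}=\{m_1,\dots,m_r\}$ of nonzero vectors $m_j=(c_j,d_j)\in\mathbb{R}^2$, no two of which are parallel; equivalently, the slopes $\mu_j=d_j/c_j\in\mathbb{R}\cup\{\infty\}$ are distinct. (For actual chess pieces the $m_j$ are integer vectors, but rationality of the slopes is not needed for combinatorial types.) The moves are indexed so that $\mu_1<\mu_2<\cdots<\mu_r$, with $\infty$ regarded as larger than every real number. A piece at $z_0$ attacks every point $z$ with $z-z_0=\lambda m_j$ for some $j$ and some $\lambda\in\mathbb{R}$; the line through $z_0$ in direction $m_j$ is its $j$-th move line. **Nonattacking configuration.** A nonattacking configuration of $q$ labelled copies $\mathbb{P}_1,\dots,\mathbb{P}_q$ of $\mathbb{P}$ on the board of order $n$ is a $q$-tuple $(z_1,\dots,z_q)$ of points of $(n+1)\mathcal{B}^\circ\cap\mathbb{Z}^2$ such that $z_k$ does not lie on any move line through $z_i$ whenever $i\ne k$. **Combinatorial type.** Orient each move line by the direction of its basic move, so that it has a left side and a right side. The labelled combinatorial type of a nonattacking configuration is the function that assigns to each triple $(i,j,k)$ with $i,k\in\{1,\dots,q\}$, $i\neq k$, $j\in\{1,\dots,r\}$,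 the side (left or right) of the $j$-th move line of $\mathbb{P}_i$ on which $\mathbb{P}_k$ lies, i.e. the sign of $\det(m_j, z_k-z_i)$. An unlabelled combinatorial type is an equivalence class of labelled combinatorial types under permutation of the labels $1,\dots,q$ of the pieces. The set of combinatorial types (labelled or unlabelled) of $q$ copies of $\mathbb{P}$ on dilations of $\mathcal{B}$ is the set of all types that occur for nonattacking configurations on the working board of some order $n\ge1$. **Reorientation.** Reversing a set of basic moves (replacing $m_j$ by $-m_j$ for all $j$ in some $S\subseteq\{1,\dots,r\}$) interchanges left and right in the values at all triples $(i,j,k)$ with $j\in S$. Two sets of combinatorial types are equal up to reorientation if for some $S\subseteq\{1,\dots,r\}$ one is obtained from the other by interchanging left and right in all values at triples $(i,j,k)$ with $j\in S$, for every type in the set. -}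

module Defs where

open import Algebra.Bundles using (CommutativeRing)
import Algebra.Properties.Monoid.Mult as Mult
import Algebra.Properties.Monoid.Sum as Sum
open import Data.Bool.Base using (if_then_else_)
open import Data.Fin.Base as Fin using (Fin)
open import Data.Fin.Permutation as Perm using (Permutation′; _⟨$⟩ʳ_; _∘ₚ_; inverseʳ)
open import Data.Fin.Subset using (Subset)
open import Data.Fin.Subset.Properties using (_∈?_)
open import Data.Integer.Base using (ℤ; +_; -[1+_])
open import Data.Nat.Base as ℕ using (ℕ; suc)
open import Data.Product.Base using (∃; _×_; _,_; proj₁; proj₂)
open import Function.Base using (_∘_)
open import Function.Bundles using (_⇔_; Bijection; Injection)
open import Function.Properties.Inverse using (↔⇒↣)
open import Level using (Level; _⊔_; 0ℓ) renaming (suc to lsuc)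
open import Relation.Binary.Bundles using (Setoid)
open import Relation.Binary.Core using (Rel)
import Relation.Binary.Construct.Add.Supremum.Strict as AddSupremum
open import Relation.Binary.Definitions using (tri<; tri≈; tri>)
open import Relation.Binary.PropositionalEquality.Core as ≡ using (_≡_; _≢_; refl)
import Relation.Binary.PropositionalEquality.Properties as ≡
open import Relation.Binary.Structures using (IsStrictTotalOrder)
open import Relation.Nullary.Construct.Add.Supremum using (_⁺; [_]; ⊤⁺)
open import Relation.Nullary.Decidable.Core using (does)
open import Relation.Nullary.Negation.Core using (¬_)
open import Relation.Unary using (Pred)

-- The axioms that characterise ℝ classically up to isomorphism.  Theorems
-- about ℝ are stated for an arbitrary model of them; the order is decidable
-- (trichotomous), as it is classically.
record CompleteOrderedField (c ℓ₁ ℓ₂ : Level) : Set (lsuc (c ⊔ ℓ₁ ⊔ ℓ₂)) where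
  infix 4 _<_ _≤_
  field
    commutativeRing : CommutativeRing c ℓ₁

  open CommutativeRing commutativeRing public

  field
    _<_                : Rel Carrier ℓ₂
    isStrictTotalOrder : IsStrictTotalOrder _≈_ _<_
    0<1                : 0# < 1#
    +-monoˡ-<          : ∀ z {x y} → x < y → x + z < y + z
    *-pos              : ∀ {x y} → 0# < x → 0# < y → 0# < x * y
    inverse            : ∀ x → ¬ x ≈ 0# → ∃ λ y → x * y ≈ 1#

  _≤_ : Rel Carrier ℓ₂
  x ≤ y = ¬ y < x

  -- The second clause says that nothing below s is an upper bound, in the
  -- constructive form: anything below s is exceeded by a member of A.
  IsSupremum : Pred Carrier (c ⊔ ℓ₁ ⊔ ℓ₂) → Carrier → Set (c ⊔ ℓ₁ ⊔ ℓ₂)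
  IsSupremum A s = (∀ x → A x → x ≤ s)
                 × (∀ y → y < s → ∃ λ x → A x × y < x)

  field
    complete : (A : Pred Carrier (c ⊔ ℓ₁ ⊔ ℓ₂)) →
               ∃ A → (∃ λ b → ∀ x → A x → x ≤ b) → ∃ (IsSupremum A)

data Side : Set where
  left right : Side

opposite : Side → Side
opposite left  = right
opposite right = left

-- T i j k is the side of the j-th move line of piece i on which piece k lies.
-- The proof of i ≢ k is irrelevant, so T is determined by its values at triples.
LabelledType : ℕ → ℕ → Set
LabelledType q r = (i : Fin q) (j : Fin r) (k : Fin q) → .(i ≢ k) → Side

module _ {q r : ℕ} where

  infix 4 _≐_ _∼_
  _≐_ : LabelledType q r → LabelledType q r → Set
  T ≐ U = ∀ i j k (i≢k : i ≢ k) → T i j k i≢k ≡ U i j k i≢k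

  relabel : Permutation′ q → LabelledType q r → LabelledType q r
  relabel π T i j k i≢k =
    T (π ⟨$⟩ʳ i) j (π ⟨$⟩ʳ k) (i≢k ∘ Injection.injective (↔⇒↣ π))

  -- Equality of unlabelled types.
  _∼_ : LabelledType q r → LabelledType q r → Set
  T ∼ U = ∃ λ (π : Permutation′ q) → U ≐ relabel π T

  ∼-refl : ∀ T → T ∼ T
  ∼-refl _ = Perm.id , λ _ _ _ _ → refl

  private
    -- The irrelevant argument only has to be supplied, not compared.
    cong-ends : (T : LabelledType q r) (j : Fin r) {i i′ k k′ : Fin q} →
                i ≡ i′ → k ≡ k′ → .(p : i ≢ k) .(p′ : i′ ≢ k′) →
                T i j k p ≡ T i′ j k′ p′
    cong-ends T j refl refl p p′ = refl

  ∼-sym : ∀ T U → T ∼ U → U ∼ T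
  ∼-sym T _ (π , U≐πT) = Perm.flip π , λ i j k i≢k → ≡.sym (≡.trans
    (U≐πT (Perm.flip π ⟨$⟩ʳ i) j (Perm.flip π ⟨$⟩ʳ k)
      (i≢k ∘ Injection.injective (↔⇒↣ (Perm.flip π))))
    (cong-ends T j (inverseʳ π) (inverseʳ π) _ i≢k))

  ∼-trans : ∀ T U V → T ∼ U → U ∼ V → T ∼ V
  ∼-trans _ _ _ (π , U≐πT) (ρ , V≐ρU) = ρ ∘ₚ π , λ i j k i≢k → ≡.trans
    (V≐ρU i j k i≢k)
    (U≐πT (ρ ⟨$⟩ʳ i) j (ρ ⟨$⟩ʳ k) (i≢k ∘ Injection.injective (↔⇒↣ ρ)))

  reorient : Subset r → LabelledType q r → LabelledType q r
  reorient S T i j k i≢k =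
    if does (j ∈? S) then opposite (T i j k i≢k) else T i j k i≢k

  -- 𝒰 is the image of 𝒯 under the reorientation of some set S of moves.  For
  -- sets of labelled types this entails the same for the sets of their
  -- unlabelled classes, since reorient S commutes with relabelling.
  EqualUpToReorientation : ∀ {a b} → Pred (LabelledType q r) a →
                           Pred (LabelledType q r) b → Set (a ⊔ b)
  EqualUpToReorientation 𝒯 𝒰 = ∃ λ (S : Subset r) →
    ∀ U → 𝒰 U ⇔ (∃ λ T → 𝒯 T × U ≐ reorient S T)

  -- The classes under ∼ of the members of 𝒯.
  unlabelled : ∀ {a} → Pred (LabelledType q r) a → Setoid a 0ℓ
  unlabelled 𝒯 = record
    { Carrier       = ∃ 𝒯
    ; _≈_           = λ T U → proj₁ T ∼ proj₁ U
    ; isEquivalence = record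
        { refl  = λ {T} → ∼-refl (proj₁ T)
        ; sym   = λ {T} {U} → ∼-sym (proj₁ T) (proj₁ U)
        ; trans = λ {T} {U} {V} → ∼-trans (proj₁ T) (proj₁ U) (proj₁ V)
        }
    }

HasCardinality : ∀ {a ℓ} → Setoid a ℓ → ℕ → Set (a ⊔ ℓ)
HasCardinality S N = Bijection S (≡.setoid (Fin N))

module Plane {c ℓ₁ ℓ₂} (ℝ : CompleteOrderedField c ℓ₁ ℓ₂) where
  open CompleteOrderedField ℝ renaming (refl to ≈-refl)
  open IsStrictTotalOrder isStrictTotalOrder using (compare)
  open Sum +-monoid using (sum)
  open Mult +-monoid using () renaming (_×_ to _·_)
  open AddSupremum _<_ using (_<⁺_)

  ℝ² : Set c
  ℝ² = Carrier × Carrier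

  infix 4 _≈₂_
  _≈₂_ : Rel ℝ² ℓ₁
  (x , y) ≈₂ (x′ , y′) = x ≈ x′ × y ≈ y′

  0₂ : ℝ²
  0₂ = 0# , 0#

  infixl 6 _−_
  _−_ : ℝ² → ℝ² → ℝ²
  (x , y) − (x′ , y′) = x - x′ , y - y′

  infixr 7 _∙_
  _∙_ : Carrier → ℝ² → ℝ²
  t ∙ (x , y) = t * x , t * y

  det : ℝ² → ℝ² → Carrier
  det (x , y) (x′ , y′) = x * y′ - y * x′

  fromℕ : ℕ → Carrier
  fromℕ n = n · 1#

  fromℤ : ℤ → Carrier
  fromℤ (+ n)    = fromℕ n
  fromℤ -[1+ n ] = - fromℕ (suc n)

  fromℤ² : ℤ × ℤ → ℝ²
  fromℤ² (x , y) = fromℤ x , fromℤ y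

  Interior : ∀ {a} → Pred ℝ² a → Pred ℝ² (c ⊔ ℓ₂ ⊔ a)
  Interior A (x , y) = ∃ λ ε → 0# < ε × (∀ x′ y′ →
    (x′ - x) * (x′ - x) + (y′ - y) * (y′ - y) < ε * ε → A (x′ , y′))

  ConvexHull : ∀ {n} → (Fin n → ℝ²) → Pred ℝ² (c ⊔ ℓ₁ ⊔ ℓ₂)
  ConvexHull {n} v z = ∃ λ (w : Fin n → Carrier) →
      (∀ i → 0# ≤ w i)
    × sum w ≈ 1#
    × (sum (λ i → w i * proj₁ (v i)) , sum (λ i → w i * proj₂ (v i))) ≈₂ z

  -- A closed, bounded, convex polygonal region is the convex hull of finitely
  -- many points.
  record Board : Set (c ⊔ ℓ₁ ⊔ ℓ₂) where
    field
      size     : ℕ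
      vertices : Fin size → ℝ²

    region : Pred ℝ² (c ⊔ ℓ₁ ⊔ ℓ₂)
    region = ConvexHull vertices

    field
      nonempty-interior : ∃ (Interior region)

  WorkingBoard : Board → ℕ → Pred (ℤ × ℤ) (c ⊔ ℓ₁ ⊔ ℓ₂)
  WorkingBoard B n z = ∃ λ p →
    Interior (Board.region B) p × fromℤ² z ≈₂ fromℕ (suc n) ∙ p

  -- Slopes in ℝ ∪ {∞}, where ⊤⁺ is ∞.
  slope : ℝ² → Carrier ⁺
  slope (x , y) with compare x 0#
  ... | tri< _ x≉0 _ = [ y * proj₁ (inverse x x≉0) ]
  ... | tri≈ _ _   _ = ⊤⁺
  ... | tri> _ x≉0 _ = [ y * proj₁ (inverse x x≉0) ]

  Parallel : Rel ℝ² ℓ₁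
  Parallel u v = det u v ≈ 0#

  record Rider (r : ℕ) : Set (c ⊔ ℓ₁ ⊔ ℓ₂) where
    field
      move        : Fin r → ℝ²
      nonzero     : ∀ j → ¬ move j ≈₂ 0₂
      nonparallel : ∀ i j → i ≢ j → ¬ Parallel (move i) (move j)
      increasing  : ∀ i j → i Fin.< j → slope (move i) <⁺ slope (move j)

  module _ {r : ℕ} (P : Rider r) where
    open Rider P

    Attacks : ℝ² → ℝ² → Set (c ⊔ ℓ₁)
    Attacks z₀ z = ∃ λ j → ∃ λ t → z − z₀ ≈₂ t ∙ move j

    Nonattacking : ∀ {q} → (Fin q → ℝ²) → Set (c ⊔ ℓ₁)
    Nonattacking z = ∀ i k → i ≢ k → ¬ Attacks (z i) (z k)

    -- v lies on the given side of the line through the origin directed by m.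
    OnSide : Side → ℝ² → ℝ² → Set ℓ₂
    OnSide left  m v = 0# < det m v
    OnSide right m v = det m v < 0#

    -- A nonattacking configuration has exactly one type, up to ≐.
    HasType : ∀ {q} → (Fin q → ℝ²) → LabelledType q r → Set ℓ₂
    HasType z T = ∀ i j k (i≢k : i ≢ k) →
      OnSide (T i j k i≢k) (move j) (z k − z i)

    -- The set of labelled types of q copies of P on dilations of B.
    Types : (q : ℕ) → Board → Pred (LabelledType q r) (c ⊔ ℓ₁ ⊔ ℓ₂)
    Types q B T = ∃ λ n → 1 ℕ.≤ n × (∃ λ (z : Fin q → ℤ × ℤ) →
        (∀ i → WorkingBoard B n (z i))
      × Nonattacking (fromℤ² ∘ z)
      × HasType (fromℤ² ∘ z) T)

-- Reverse moves so that det (m i) (m j) > 0 for i < j.  By the Plücker relation,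
-- for each pair of pieces the sides are then left for the moves up to a
-- threshold and right afterwards (or conversely), and for each move the sides
-- order the pieces linearly.  Label the pieces in their order for the first move:
-- the type is given by thresholds x, w, y < r of the pairs 01, 02, 12, and the
-- linear orders say exactly that w lies between x and y.
--
-- Every such triple occurs: choose rays u, v, z in the three sectors, angularly
-- ordered; then det u z ∙ v = det v z ∙ u + det u v ∙ z closes up a triangle.
-- Its type is an open condition invariant under scaling and translation, so a large
-- copy of it rounds to lattice points, in the interior of a large enough board.
--
-- Splitting off the triples that contain the least value 0 counts the triples:
-- N (r + 1) = N r + (r + 1) + r + 2 · r (r + 1) / 2.

module Submission where

open import Algebra.Bundles using (CommutativeRing; RawRing)
import Algebra.Properties.AbelianGroup
import Algebra.Properties.Ring
import Algebra.Properties.Semiring.Mult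
import Algebra.Solver.Ring
open import Algebra.Solver.Ring.AlmostCommutativeRing
  using (fromCommutativeRing; _-Raw-AlmostCommutative⟶_)
open import Data.Bool.Base using (Bool; true; false; if_then_else_; _xor_)
open import Data.Empty using (⊥-elim)
open import Data.Fin.Base as Fin using (Fin; zero; suc; inject₁; splitAt; join)
open import Data.Fin.Patterns using (0F; 1F; 2F)
open import Data.Fin.Permutation as Perm using (Permutation′; _⟨$⟩ʳ_; _∘ₚ_; transpose)
import Data.Fin.Properties as Fin
open import Data.Fin.Relation.Unary.Top using (view; ‵fromℕ; ‵inj₁)
open import Data.Fin.Subset using (Subset)
open import Data.Fin.Subset.Properties using (_∈?_)
open import Data.Integer.Base as ℤ using (ℤ; +_; -[1+_]; _⊖_)
import Data.Integer.Properties as ℤ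
open import Data.Maybe.Base using (Maybe; just; nothing)
open import Data.Nat.Base as ℕ using (zero; suc; s≤s; z≤n)
import Data.Nat.Properties as ℕ
open import Data.Nat.Tactic.RingSolver using (solve-∀)
open import Data.Nat using (ℕ)
open import Data.Product using (∃; _×_)
open import Data.Product.Base using (_,_; proj₁; proj₂)
open import Data.Product.Properties using (,-injectiveʳ)
open import Data.Sum.Base using (_⊎_; inj₁; inj₂; [_,_]′)
open import Data.Unit.Base using (⊤; tt)
open import Data.Vec.Base using (_∷_; lookup; tabulate)
open import Data.Vec.Properties using (lookup∘tabulate)
open import Function.Base using (_∘_)
open import Function.Bundles using (_⇔_; mk⇔; Bijection; Equivalence; Injection)
import Function.Construct.Symmetry as Symmetry
open import Function.Properties.Inverse using (↔⇒↣)
open import Level using (_⊔_; Lift; lift)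
import Relation.Binary.Construct.Add.Supremum.Strict as AddSupremum
open import Relation.Binary.Definitions using (tri<; tri≈; tri>)
import Relation.Binary.PropositionalEquality as ≡
open import Relation.Binary.PropositionalEquality using (_≡_; _≢_)
open import Relation.Binary.Structures using (IsStrictTotalOrder)
open import Relation.Nullary.Construct.Add.Supremum using (_⁺; [_]; ⊤⁺)
open import Relation.Nullary.Decidable.Core using (yes; no; does)
open import Relation.Nullary.Negation.Core using (¬_)
open import Relation.Unary using (Pred; _∪_)
open import Defs

-- Counting triples with the middle entry between the outer two

module Counting where
  open import Relation.Binary.PropositionalEquality
    using (refl; sym; trans; cong; cong₂; subst; module ≡-Reasoning)

  -- Injectivity compares elements only, never proofs of `P`. This matters for `Between`, which has
  -- two proofs of a triple whose entries all coincide.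
  record Enumeration {A : Set} (P : A → Set) (n : ℕ) : Set where
    field
      at        : Fin n → A
      sound     : ∀ i → P (at i)
      injective : ∀ {i j} → at i ≡ at j → i ≡ j
      complete  : ∀ {a} → P a → ∃ λ i → at i ≡ a

  module _ where
    open Enumeration

    all-Fin : ∀ n → Enumeration {Fin n} (λ _ → ⊤) n
    all-Fin n .at i            = i
    all-Fin n .sound _         = tt
    all-Fin n .injective i≡j   = i≡j
    all-Fin n .complete {a} _  = a , refl

    Image : {A B : Set} → (A → B) → (A → Set) → B → Set
    Image f P b = ∃ λ a → P a × f a ≡ b

    image : ∀ {A B : Set} {P : A → Set} {n} (f : A → B) → (∀ {a a′} → f a ≡ f a′ → a ≡ a′) →
            Enumeration P n → Enumeration (Image f P) n
    image f inj E .at i        = f (E .at i)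
    image f inj E .sound i     = E .at i , E .sound i , refl
    image f inj E .injective   = E .injective ∘ inj
    image f inj E .complete (a , p , refl) = let i , eq = E .complete p in i , cong f eq

    disjoint-union : ∀ {A : Set} {P Q : A → Set} {m n} → (∀ {a} → P a → ¬ Q a) →
                     Enumeration P m → Enumeration Q n → Enumeration (P ∪ Q) (m ℕ.+ n)
    disjoint-union {A} {P} {Q} {m} {n} disjoint E F = record
      { at = pick ∘ splitAt m
      ; sound = pick-sound ∘ splitAt m
      ; injective = λ {i} {j} eq → trans (sym (Fin.join-splitAt m n i))
          (trans (cong (join m n) (pick-injective (splitAt m i) (splitAt m j) eq)) (Fin.join-splitAt m n j))
      ; complete = λ where
          (inj₁ p) → let i , eq = E .complete p in
            i Fin.↑ˡ n , trans (cong pick (Fin.splitAt-↑ˡ m i n)) eq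
          (inj₂ q) → let i , eq = F .complete q in
            m Fin.↑ʳ i , trans (cong pick (Fin.splitAt-↑ʳ m n i)) eq
      }
      where
      pick : Fin m ⊎ Fin n → A
      pick = [ E .at , F .at ]′

      pick-sound : ∀ s → (P ∪ Q) (pick s)
      pick-sound (inj₁ i) = inj₁ (E .sound i)
      pick-sound (inj₂ i) = inj₂ (F .sound i)

      pick-injective : ∀ s t → pick s ≡ pick t → s ≡ t
      pick-injective (inj₁ i) (inj₁ j) eq = cong inj₁ (E .injective eq)
      pick-injective (inj₁ i) (inj₂ j) eq = ⊥-elim (disjoint (E .sound i) (subst Q (sym eq) (F .sound j)))
      pick-injective (inj₂ i) (inj₁ j) eq = ⊥-elim (disjoint (E .sound j) (subst Q eq (F .sound i)))
      pick-injective (inj₂ i) (inj₂ j) eq = cong inj₂ (F .injective eq)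

    Enumeration-resp : ∀ {A : Set} {P Q : A → Set} {n} →
      (∀ {a} → P a → Q a) → (∀ {a} → Q a → P a) → Enumeration P n → Enumeration Q n
    Enumeration-resp to from E = record
      { at = E .at ; sound = to ∘ E .sound ; injective = E .injective ; complete = E .complete ∘ from }

  Ascending : ∀ {n} → Fin n × Fin n → Set
  Ascending (x , y) = x Fin.≤ y

  Between : ∀ {n} → Fin n × Fin n × Fin n → Set
  Between (x , w , y) = (x Fin.≤ w × w Fin.≤ y) ⊎ (y Fin.≤ w × w Fin.≤ x)

  triangle : ℕ → ℕ
  triangle zero    = 0
  triangle (suc n) = suc n ℕ.+ triangle n

  count : ℕ → ℕ
  count zero    = 0
  count (suc n) = suc n ℕ.+ (n ℕ.+ (triangle n ℕ.+ (triangle n ℕ.+ count n)))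

  ascending : ∀ n → Enumeration (Ascending {n}) (triangle n)
  ascending zero    = record
    { at = λ () ; sound = λ () ; injective = λ { {()} } ; complete = λ { {() , _} } }
  ascending (suc n) = Enumeration-resp
    (λ { (inj₁ (_ , _ , refl)) → z≤n ; (inj₂ (_ , x≤y , refl)) → s≤s x≤y })
    (λ { {zero , y} _ → inj₁ (y , tt , refl) ; {suc x , suc y} (s≤s x≤y) → inj₂ ((x , y) , x≤y , refl) })
    (disjoint-union (λ { (_ , _ , refl) (_ , _ , ()) })
      (image (zero ,_) ,-injectiveʳ (all-Fin (suc n)))
      (image (λ (x , y) → suc x , suc y) (λ { refl → refl }) (ascending n)))

  -- If the middle entry is zero, then so is an outer one: this gives the triples (0, 0, y) and,
  -- apart from those, (x, 0, 0) with x positive. If the middle entry is positive, at most one outer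
  -- entry is zero, and the other two entries form an ascending pair read away from it. What remains
  -- has three positive entries and is a shifted copy of the same problem.
  between : ∀ n → Enumeration (Between {n}) (count n)
  between zero    = record
    { at = λ () ; sound = λ () ; injective = λ { {()} } ; complete = λ { {() , _} } }
  between (suc n) = Enumeration-resp to from
    (disjoint-union (λ { (_ , _ , refl) (inj₁ (_ , _ , ())) ; (_ , _ , refl) (inj₂ (inj₁ (_ , _ , ())))
                       ; (_ , _ , refl) (inj₂ (inj₂ (inj₁ (_ , _ , ()))))
                       ; (_ , _ , refl) (inj₂ (inj₂ (inj₂ (_ , _ , ())))) })
      (image (λ y → zero , zero , y) (λ { refl → refl }) (all-Fin (suc n)))
    (disjoint-union (λ { (_ , _ , refl) (inj₁ (_ , _ , ()))
                       ; (_ , _ , refl) (inj₂ (inj₁ (_ , _ , ()))) ; (_ , _ , refl) (inj₂ (inj₂ (_ , _ , ()))) })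
      (image (λ x → suc x , zero , zero) (λ { refl → refl }) (all-Fin n))
    (disjoint-union (λ { (_ , _ , refl) (inj₁ (_ , _ , ())) ; (_ , _ , refl) (inj₂ (_ , _ , ())) })
      (image (λ (w , y) → zero , suc w , suc y) (λ { refl → refl }) (ascending n))
    (disjoint-union (λ { (_ , _ , refl) (_ , _ , ()) })
      (image (λ (w , x) → suc x , suc w , zero) (λ { refl → refl }) (ascending n))
      (image (λ (x , w , y) → suc x , suc w , suc y) (λ { refl → refl }) (between n))))))
    where
    to : ∀ {t} → _ → Between t
    to (inj₁ (_ , _ , refl))                                    = inj₁ (z≤n , z≤n)
    to (inj₂ (inj₁ (_ , _ , refl)))                             = inj₂ (z≤n , z≤n)
    to (inj₂ (inj₂ (inj₁ (_ , w≤y , refl))))                    = inj₁ (z≤n , s≤s w≤y)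
    to (inj₂ (inj₂ (inj₂ (inj₁ (_ , w≤x , refl)))))             = inj₂ (z≤n , s≤s w≤x)
    to (inj₂ (inj₂ (inj₂ (inj₂ (_ , inj₁ (p , q) , refl)))))    = inj₁ (s≤s p , s≤s q)
    to (inj₂ (inj₂ (inj₂ (inj₂ (_ , inj₂ (p , q) , refl)))))    = inj₂ (s≤s p , s≤s q)
    from : ∀ {t} → Between t → _
    from {zero  , zero  , y    } _ = inj₁ (y , tt , refl)
    from {suc x , zero  , zero } _ = inj₂ (inj₁ (x , tt , refl))
    from {suc _ , zero  , suc _} (inj₁ (() , _))
    from {suc _ , zero  , suc _} (inj₂ (() , _))
    from {zero  , suc w , suc y} (inj₁ (_ , s≤s w≤y)) = inj₂ (inj₂ (inj₁ ((w , y) , w≤y , refl)))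
    from {suc x , suc w , zero } (inj₂ (_ , s≤s w≤x)) = inj₂ (inj₂ (inj₂ (inj₁ ((w , x) , w≤x , refl))))
    from {suc x , suc w , suc y} (inj₁ (s≤s p , s≤s q)) = inj₂ (inj₂ (inj₂ (inj₂ (_ , inj₁ (p , q) , refl))))
    from {suc x , suc w , suc y} (inj₂ (s≤s p , s≤s q)) = inj₂ (inj₂ (inj₂ (inj₂ (_ , inj₂ (p , q) , refl))))

  2*triangle : ∀ n → 2 ℕ.* triangle n ≡ n ℕ.* suc n
  2*triangle zero    = refl
  2*triangle (suc n) = begin
    2 ℕ.* (suc n ℕ.+ triangle n)          ≡⟨ ℕ.*-distribˡ-+ 2 (suc n) (triangle n) ⟩
    2 ℕ.* suc n ℕ.+ 2 ℕ.* triangle n      ≡⟨ cong (2 ℕ.* suc n ℕ.+_) (2*triangle n) ⟩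
    2 ℕ.* suc n ℕ.+ n ℕ.* suc n           ≡⟨ lemma n ⟩
    suc n ℕ.* suc (suc n)                 ∎
    where
    open ≡-Reasoning
    lemma : ∀ n → 2 ℕ.* suc n ℕ.+ n ℕ.* suc n ≡ suc n ℕ.* suc (suc n)
    lemma = solve-∀

  -- The closed formula with its subtracted term moved to the left, so that the induction stays
  -- within semiring identities.
  3*count+n : ∀ n → 3 ℕ.* count n ℕ.+ n ≡ n ℕ.* (n ℕ.^ 2 ℕ.+ 3 ℕ.* n)
  3*count+n zero    = refl
  3*count+n (suc n) = begin
    3 ℕ.* count (suc n) ℕ.+ suc n
      ≡⟨ regroup n (triangle n) (count n) ⟩
    (3 ℕ.* count n ℕ.+ n) ℕ.+ 3 ℕ.* (2 ℕ.* triangle n) ℕ.+ (6 ℕ.* n ℕ.+ 4)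
      ≡⟨ cong₂ (λ a b → a ℕ.+ 3 ℕ.* b ℕ.+ (6 ℕ.* n ℕ.+ 4)) (3*count+n n) (2*triangle n) ⟩
    n ℕ.* (n ℕ.^ 2 ℕ.+ 3 ℕ.* n) ℕ.+ 3 ℕ.* (n ℕ.* suc n) ℕ.+ (6 ℕ.* n ℕ.+ 4)
      ≡⟨ expand n ⟩
    suc n ℕ.* (suc n ℕ.^ 2 ℕ.+ 3 ℕ.* suc n) ∎
    where
    open ≡-Reasoning
    regroup : ∀ n t c → 3 ℕ.* (suc n ℕ.+ (n ℕ.+ (t ℕ.+ (t ℕ.+ c)))) ℕ.+ suc n ≡
              (3 ℕ.* c ℕ.+ n) ℕ.+ 3 ℕ.* (2 ℕ.* t) ℕ.+ (6 ℕ.* n ℕ.+ 4)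
    regroup = solve-∀
    expand : ∀ n → n ℕ.* (n ℕ.* (n ℕ.* 1) ℕ.+ 3 ℕ.* n) ℕ.+ 3 ℕ.* (n ℕ.* suc n) ℕ.+ (6 ℕ.* n ℕ.+ 4) ≡
             suc n ℕ.* (suc n ℕ.* (suc n ℕ.* 1) ℕ.+ 3 ℕ.* suc n)
    expand = solve-∀

  3*count : ∀ r → 1 ℕ.≤ r → 3 ℕ.* count r ≡ r ℕ.* (r ℕ.^ 2 ℕ.+ 3 ℕ.* r ℕ.∸ 1)
  -- For `r = suc n` the sum `r ^ 2 + 3 * r` computes to a successor, so `∸ 1` removes it and
  -- `*-suc` splits off the summand `r` to be cancelled.
  3*count r@(suc n) _ = ℕ.+-cancelʳ-≡ r _ _ (trans (3*count+n r)
    (trans (ℕ.*-suc r _) (ℕ.+-comm r _)))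

-- Combinatorial types of three pieces

module TypesOfThree where
  open import Relation.Binary.PropositionalEquality
    using (refl; sym; trans; cong; cong₂; subst; module ≡-Reasoning)
  open Counting

  opposite-involutive : ∀ s → opposite (opposite s) ≡ s
  opposite-involutive left  = refl
  opposite-involutive right = refl

  flip : Bool → Side → Side
  flip b s = if b then opposite s else s

  flip-self : ∀ b s → flip b (flip b s) ≡ s
  flip-self true  s = opposite-involutive s
  flip-self false s = refl

  flip-xorˡ : ∀ a b s → flip a (flip (a xor b) s) ≡ flip b s
  flip-xorˡ true  true  s = refl
  flip-xorˡ true  false s = opposite-involutive s
  flip-xorˡ false b     s = refl

  flip-xorʳ : ∀ a b s → flip b (flip (a xor b) s) ≡ flip a s
  flip-xorʳ true  true  s = refl
  flip-xorʳ false true  s = opposite-involutive s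
  flip-xorʳ true  false s = refl
  flip-xorʳ false false s = refl

  -- This is `reorient` for a set of moves given by its characteristic function; composing two such
  -- flips is then a matter of `_xor_`.
  flips : ∀ {q r} → (Fin r → Bool) → LabelledType q r → LabelledType q r
  flips o T i j k i≢k = flip (o j) (T i j k i≢k)

  does-∈? : ∀ {n} (j : Fin n) (S : Subset n) → does (j ∈? S) ≡ lookup S j
  does-∈? zero    (true ∷ S)  = refl
  does-∈? zero    (false ∷ S) = refl
  does-∈? (suc j) (_ ∷ S)     = does-∈? j S

  reorient-tabulate : ∀ {q r} (o : Fin r → Bool) (T : LabelledType q r) →
                      reorient (tabulate o) T ≐ flips o T
  reorient-tabulate o T i j k i≢k =
    cong (λ b → flip b (T i j k i≢k)) (trans (does-∈? j (tabulate o)) (lookup∘tabulate o j))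

  -- The combinatorial trace of moves that are angularly increasing within a half turn. By `convex`,
  -- used for both sides, the side changes at most once as the move index grows; `antisymmetric` and
  -- `transitive` make each move order the pieces linearly. For three pieces these conditions turn
  -- out to characterise the types that occur.
  record Admissible {q r : ℕ} (T : LabelledType q r) : Set where
    field
      antisymmetric : ∀ i j k (i≢k : i ≢ k) (k≢i : k ≢ i) →
                      T k j i k≢i ≡ opposite (T i j k i≢k)
      convex        : ∀ i k (i≢k : i ≢ k) {j₁ j₂ j₃} s → j₁ Fin.< j₂ → j₂ Fin.< j₃ →
                      T i j₁ k i≢k ≡ s → T i j₃ k i≢k ≡ s → T i j₂ k i≢k ≡ s
      transitive    : ∀ i j k l (i≢k : i ≢ k) (k≢l : k ≢ l) (i≢l : i ≢ l) s →
                      T i j k i≢k ≡ s → T k j l k≢l ≡ s → T i j l i≢l ≡ s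

  open Admissible

  relabel-Admissible : ∀ {q r} (π : Permutation′ q) {T : LabelledType q r} →
                       Admissible T → Admissible (relabel π T)
  relabel-Admissible π A = record
    { antisymmetric = λ i j k i≢k k≢i → A .antisymmetric _ j _ (i≢k ∘ inj) (k≢i ∘ inj)
    ; convex = λ i k i≢k → A .convex _ _ (i≢k ∘ inj)
    ; transitive = λ i j k l i≢k k≢l i≢l → A .transitive _ j _ _ (i≢k ∘ inj) (k≢l ∘ inj) (i≢l ∘ inj)
    }
    where
    inj : ∀ {i k} → π ⟨$⟩ʳ i ≡ π ⟨$⟩ʳ k → i ≡ k
    inj = Injection.injective (↔⇒↣ π)

  -- The threshold is the last move whose side is left. A sequence of sides that begins with left
  -- thus has its threshold in `Fin n`, even if it never changes.
  step : ∀ {n} → Fin n → Fin n → Side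
  step zero    zero    = left
  step zero    (suc _) = right
  step (suc t) zero    = left
  step (suc t) (suc j) = step t j

  step-≤ : ∀ {n} {t j : Fin n} → j Fin.≤ t → step t j ≡ left
  step-≤ {t = zero}  {zero}  _       = refl
  step-≤ {t = suc t} {zero}  _       = refl
  step-≤ {t = suc t} {suc j} (s≤s p) = step-≤ p

  step-> : ∀ {n} {t j : Fin n} → t Fin.< j → step t j ≡ right
  step-> {t = zero}  {suc j} _       = refl
  step-> {t = suc t} {suc j} (s≤s p) = step-> p

  step-left⇒≤ : ∀ {n} (t j : Fin n) → step t j ≡ left → j Fin.≤ t
  step-left⇒≤ t j eq with j Fin.≤? t
  ... | yes j≤t = j≤t
  ... | no  j≰t with trans (sym eq) (step-> (ℕ.≰⇒> j≰t))
  ...   | ()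

  step-injective : ∀ {n} (t u : Fin n) → (∀ j → step t j ≡ step u j) → t ≡ u
  step-injective t u eq = Fin.≤-antisym
    (step-left⇒≤ u t (trans (sym (eq t)) (step-≤ {t = t} ℕ.≤-refl)))
    (step-left⇒≤ t u (trans (eq u) (step-≤ {t = u} ℕ.≤-refl)))

  threshold : ∀ {n} (f : Fin (suc n) → Side) → f zero ≡ left →
              (∀ {i j} → i Fin.< j → f j ≡ left → f i ≡ left) →
              ∃ λ t → ∀ j → step t j ≡ f j
  threshold {zero}  f f0 down = zero , λ { zero → sym f0 }
  threshold {suc n} f f0 down with f (suc zero) in f1
  ... | left  = let t , eq = threshold (f ∘ suc) f1 (down ∘ s≤s) in
                suc t , λ { zero → sym f0 ; (suc j) → eq j }
  ... | right = zero , λ { zero → sym f0 ; (suc j) → sym (rest j) }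
    where
    rest : ∀ j → f (suc j) ≡ right
    rest zero = f1
    rest (suc j) with f (suc (suc j)) in eq
    ... | right = refl
    ... | left with trans (sym f1) (down (s≤s (s≤s z≤n)) eq)
    ...   | ()

  -- The threshold moves of the pairs 01, 02 and 12 of pieces.  The value left on
  -- the diagonal is junk.
  standard : ∀ {r} → Fin r × Fin r × Fin r → LabelledType 3 r
  standard (x , w , y) 0F j 1F _ = step x j
  standard (x , w , y) 0F j 2F _ = step w j
  standard (x , w , y) 1F j 2F _ = step y j
  standard (x , w , y) 1F j 0F _ = opposite (step x j)
  standard (x , w , y) 2F j 0F _ = opposite (step w j)
  standard (x , w , y) 2F j 1F _ = opposite (step y j)
  standard _           _  _ _  _ = left

  -- The first move is at or below every threshold, so it orders the pieces of a standard type by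
  -- their labels.
  standard-zero : ∀ {n} (t : Fin (suc n) × Fin (suc n) × Fin (suc n)) i k (i≢k : i ≢ k) →
                  standard t i zero k i≢k ≡ left → i Fin.< k
  standard-zero t 0F 0F i≢k _ = ⊥-elim (i≢k refl)
  standard-zero t 1F 1F i≢k _ = ⊥-elim (i≢k refl)
  standard-zero t 2F 2F i≢k _ = ⊥-elim (i≢k refl)
  standard-zero t 0F 1F _ _ = s≤s z≤n
  standard-zero t 0F 2F _ _ = s≤s z≤n
  standard-zero t 1F 2F _ _ = s≤s (s≤s z≤n)
  standard-zero (x , w , y) 1F 0F _ eq with trans (sym eq) (cong opposite (step-≤ {t = x} z≤n))
  ... | ()
  standard-zero (x , w , y) 2F 0F _ eq with trans (sym eq) (cong opposite (step-≤ {t = w} z≤n))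
  ... | ()
  standard-zero (x , w , y) 2F 1F _ eq with trans (sym eq) (cong opposite (step-≤ {t = y} z≤n))
  ... | ()

  increasing-id : ∀ {a b c : Fin 3} → a Fin.< b → b Fin.< c → (a ≡ 0F) × (b ≡ 1F) × (c ≡ 2F)
  increasing-id {0F} {1F} {2F} _ _ = refl , refl , refl
  increasing-id {_}  {1F} {1F} _ (s≤s ())
  increasing-id {_}  {2F} {1F} _ (s≤s ())
  increasing-id {_}  {2F} {2F} _ (s≤s (s≤s ()))
  increasing-id {1F} {1F} {_} (s≤s ()) _
  increasing-id {2F} {1F} {_} (s≤s ()) _

  -- A relabelling between standard types preserves the order that the first move gives. It is
  -- therefore strictly increasing, hence the identity, and the thresholds can be compared pair by
  -- pair.
  standard-injective : ∀ {n} (t u : Fin (suc n) × Fin (suc n) × Fin (suc n)) →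
                       standard t ∼ standard u → t ≡ u
  standard-injective {n} t@(x , w , y) u@(x′ , w′ , y′) (π , eq) =
    cong₂ _,_ (step-injective x x′ (agree 0F 1F (λ ())))
      (cong₂ _,_ (step-injective w w′ (agree 0F 2F (λ ()))) (step-injective y y′ (agree 1F 2F (λ ()))))
    where
    inj : ∀ {i k} → π ⟨$⟩ʳ i ≡ π ⟨$⟩ʳ k → i ≡ k
    inj = Injection.injective (↔⇒↣ π)

    mono : ∀ i k (i≢k : i ≢ k) → standard u i zero k i≢k ≡ left → π ⟨$⟩ʳ i Fin.< π ⟨$⟩ʳ k
    mono i k i≢k ≡left = standard-zero t _ _ (i≢k ∘ inj) (trans (sym (eq i zero k i≢k)) ≡left)

    ids = increasing-id (mono 0F 1F (λ ()) (step-≤ {t = x′} z≤n)) (mono 1F 2F (λ ()) (step-≤ {t = y′} z≤n))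

    π-id : ∀ i → π ⟨$⟩ʳ i ≡ i
    π-id 0F = proj₁ ids
    π-id 1F = proj₁ (proj₂ ids)
    π-id 2F = proj₂ (proj₂ ids)

    -- The images under `π` are generalised to variables `a` and `b`, which lets both equations be
    -- matched with `refl`.
    at-id : ∀ i k j .(i≢k : i ≢ k) a b .(a≢b : a ≢ b) → a ≡ i → b ≡ k →
            standard t a j b a≢b ≡ standard t i j k i≢k
    at-id i k j i≢k a b a≢b refl refl = refl

    agree : ∀ i k (i≢k : i ≢ k) j → standard t i j k i≢k ≡ standard u i j k i≢k
    agree i k i≢k j = trans (sym (at-id i k j i≢k _ _ (i≢k ∘ inj) (π-id i) (π-id k))) (sym (eq i j k i≢k))

  reverse-right : ∀ {q r} {T : LabelledType q r} → Admissible T → ∀ {i j k} (i≢k : i ≢ k) (k≢i : k ≢ i) →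
                  T i j k i≢k ≡ right → T k j i k≢i ≡ left
  reverse-right A i≢k k≢i eq = trans (A .antisymmetric _ _ _ i≢k k≢i) (cong opposite eq)

  -- The permutation sends each position in the order of the first move to the piece that stands
  -- there. If the pairs 01 and 12 have the same side, the order is already determined; otherwise
  -- the pair 02 decides it.
  sorted : ∀ {n} {T : LabelledType 3 (suc n)} → Admissible T →
           ∃ λ π → relabel π T 0F zero 1F (λ ()) ≡ left × relabel π T 1F zero 2F (λ ()) ≡ left
  sorted {T = T} A
    with T 0F zero 1F (λ ()) in e₀₁ | T 1F zero 2F (λ ()) in e₁₂ | T 0F zero 2F (λ ()) in e₀₂
  ... | left  | left  | _     = Perm.id , e₀₁ , e₁₂
  ... | left  | right | left  = transpose 1F 2F , e₀₂ , reverse-right A (λ ()) (λ ()) e₁₂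
  ... | left  | right | right = transpose 0F 1F ∘ₚ transpose 1F 2F , reverse-right A (λ ()) (λ ()) e₀₂ , e₀₁
  ... | right | left  | left  = transpose 0F 1F , reverse-right A (λ ()) (λ ()) e₀₁ , e₀₂
  ... | right | left  | right = transpose 1F 2F ∘ₚ transpose 0F 1F , e₁₂ , reverse-right A (λ ()) (λ ()) e₀₂
  ... | right | right | _     = transpose 0F 2F ,
    reverse-right A (λ ()) (λ ()) e₁₂ , reverse-right A (λ ()) (λ ()) e₀₁

  -- The hypothesis `low` at the smaller of `x` and `y` shows that `w` is at least that one. If `w`
  -- exceeded the larger one, `high` at `w` itself would give `w < w`.
  Between-intro : ∀ {n} {x w y : Fin n} →
    (∀ j → j Fin.≤ x → j Fin.≤ y → j Fin.≤ w) →
    (∀ j → x Fin.< j → y Fin.< j → w Fin.< j) → Between (x , w , y)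
  Between-intro {x = x} {w} {y} low high with Fin.≤-total x y
  ... | inj₁ x≤y = inj₁ (low x ℕ.≤-refl x≤y ,
    ℕ.≮⇒≥ λ y<w → ℕ.<-irrefl refl (high w (ℕ.≤-<-trans x≤y y<w) y<w))
  ... | inj₂ y≤x = inj₂ (low y y≤x ℕ.≤-refl ,
    ℕ.≮⇒≥ λ x<w → ℕ.<-irrefl refl (high w x<w (ℕ.≤-<-trans y≤x x<w)))

  right⇒> : ∀ {n} (t j : Fin n) → step t j ≡ right → t Fin.< j
  right⇒> t j eq = ℕ.≰⇒> λ j≤t → left≢right (trans (sym (step-≤ j≤t)) eq)
    where
    left≢right : ¬ left ≡ right
    left≢right ()

  Admissible⇒standard : ∀ {n} {T : LabelledType 3 (suc n)} → Admissible T →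
                        ∃ λ t → Between t × T ∼ standard t
  Admissible⇒standard {n} {T} A = (x , w , y) , between-xwy , π , agree
    where
    π = proj₁ (sorted A)

    T′ : LabelledType 3 (suc n)
    T′ = relabel π T

    A′ : Admissible T′
    A′ = relabel-Admissible π A

    first₀₁ : T′ 0F zero 1F (λ ()) ≡ left
    first₀₁ = proj₁ (proj₂ (sorted A))

    first₁₂ : T′ 1F zero 2F (λ ()) ≡ left
    first₁₂ = proj₂ (proj₂ (sorted A))

    pair : ∀ i k (i≢k : i ≢ k) → T′ i zero k i≢k ≡ left → ∃ λ t → ∀ j → step t j ≡ T′ i j k i≢k
    pair i k i≢k first = threshold (λ j → T′ i j k i≢k) first down
      where
      down : ∀ {a b} → a Fin.< b → T′ i b k i≢k ≡ left → T′ i a k i≢k ≡ left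
      down {zero}  a<b _  = first
      -- The move lies between the first move and `b`, both of which have side left.
      down {suc a} a<b eq = A′ .convex i k i≢k left (s≤s z≤n) a<b first eq

    pair₀₁ = pair 0F 1F (λ ()) first₀₁
    pair₁₂ = pair 1F 2F (λ ()) first₁₂
    pair₀₂ = pair 0F 2F (λ ()) (A′ .transitive 0F zero 1F 2F (λ ()) (λ ()) (λ ()) left first₀₁ first₁₂)

    x = proj₁ pair₀₁
    w = proj₁ pair₀₂
    y = proj₁ pair₁₂

    same : ∀ s j → step x j ≡ s → step y j ≡ s → step w j ≡ s
    same s j p q = trans (proj₂ pair₀₂ j) (A′ .transitive 0F j 1F 2F (λ ()) (λ ()) (λ ()) s
      (trans (sym (proj₂ pair₀₁ j)) p) (trans (sym (proj₂ pair₁₂ j)) q))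

    between-xwy : Between (x , w , y)
    between-xwy = Between-intro
      (λ j j≤x j≤y → step-left⇒≤ w j (same left j (step-≤ j≤x) (step-≤ j≤y)))
      (λ j x<j y<j → right⇒> w j (same right j (step-> x<j) (step-> y<j)))

    agree : standard (x , w , y) ≐ T′
    agree 0F j 0F i≢i = ⊥-elim (i≢i refl)
    agree 1F j 1F i≢i = ⊥-elim (i≢i refl)
    agree 2F j 2F i≢i = ⊥-elim (i≢i refl)
    agree 0F j 1F _ = proj₂ pair₀₁ j
    agree 0F j 2F _ = proj₂ pair₀₂ j
    agree 1F j 2F _ = proj₂ pair₁₂ j
    agree 1F j 0F _ = trans (cong opposite (proj₂ pair₀₁ j)) (sym (A′ .antisymmetric 0F j 1F (λ ()) (λ ())))
    agree 2F j 0F _ = trans (cong opposite (proj₂ pair₀₂ j)) (sym (A′ .antisymmetric 0F j 2F (λ ()) (λ ())))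
    agree 2F j 1F _ = trans (cong opposite (proj₂ pair₁₂ j)) (sym (A′ .antisymmetric 1F j 2F (λ ()) (λ ())))

  ≐-trans : ∀ {q r} {T U V : LabelledType q r} → T ≐ U → U ≐ V → T ≐ V
  ≐-trans p q i j k i≢k = trans (p i j k i≢k) (q i j k i≢k)

  ≐-sym : ∀ {q r} {T U : LabelledType q r} → T ≐ U → U ≐ T
  ≐-sym p i j k i≢k = sym (p i j k i≢k)

  flips-self : ∀ {q r} (o : Fin r → Bool) (T : LabelledType q r) → flips o (flips o T) ≐ T
  flips-self o T i j k i≢k = flip-self (o j) (T i j k i≢k)

  flips-∼ : ∀ {q r} (o : Fin r → Bool) (T U : LabelledType q r) → T ∼ U → flips o T ∼ flips o U
  flips-∼ o T U (π , p) = π , λ i j k i≢k → cong (flip (o j)) (p i j k i≢k)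

  ≐⇒∼ : ∀ {q r} {T U : LabelledType q r} → T ≐ U → T ∼ U
  ≐⇒∼ p = Perm.id , ≐-sym p

  Admissible-resp : ∀ {q r} (T U : LabelledType q r) → T ≐ U → Admissible T → Admissible U
  Admissible-resp T U eq A = record
    { antisymmetric = λ i j k i≢k k≢i → trans (sym (eq k j i k≢i))
        (trans (A .antisymmetric i j k i≢k k≢i) (cong opposite (eq i j k i≢k)))
    ; convex = λ i k i≢k s p q e₁ e₃ → trans (sym (eq _ _ _ i≢k))
        (A .convex i k i≢k s p q (trans (eq _ _ _ i≢k) e₁) (trans (eq _ _ _ i≢k) e₃))
    ; transitive = λ i j k l i≢k k≢l i≢l s e₁ e₂ → trans (sym (eq _ _ _ i≢l))
        (A .transitive i j k l i≢k k≢l i≢l s (trans (eq _ _ _ i≢k) e₁) (trans (eq _ _ _ k≢l) e₂))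
    }

  module _ {n} (o : Fin (suc n) → Bool) where

    module Triples = Enumeration (between (suc n))

    type : Fin (count (suc n)) → LabelledType 3 (suc n)
    type a = flips o (standard (Triples.at a))

    type-injective : ∀ a b → type a ∼ type b → a ≡ b
    type-injective a b e = Triples.injective (standard-injective (Triples.at a) (Triples.at b)
      (∼-trans (standard (Triples.at a)) (flips o (type a)) (standard (Triples.at b))
        (≐⇒∼ (≐-sym (flips-self o (standard (Triples.at a)))))
        (∼-trans (flips o (type a)) (flips o (type b)) (standard (Triples.at b))
          (flips-∼ o (type a) (type b) e) (≐⇒∼ (flips-self o (standard (Triples.at b)))))))

    type-surjective : ∀ T → Admissible (flips o T) → ∃ λ a → type a ∼ T
    type-surjective T A with Admissible⇒standard A
    ... | t , t-between , T∼t with Triples.complete t-between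
    ...   | a , refl = a , ∼-trans (type a) (flips o (flips o T)) T
      (flips-∼ o (standard (Triples.at a)) (flips o T) (∼-sym (flips o T) (standard (Triples.at a)) T∼t))
      (≐⇒∼ (flips-self o T))

    Admissible-cardinality : ∀ {ℓ} (𝒯 : Pred (LabelledType 3 (suc n)) ℓ) →
      (∀ T → 𝒯 T → Admissible (flips o T)) → (∀ t → Between t → 𝒯 (flips o (standard t))) →
      HasCardinality (unlabelled 𝒯) (count (suc n))
    -- The bijection is easier to give from indices to types. To invert it, equivalent types must
    -- get equal indices, which follows from injectivity.
    Admissible-cardinality 𝒯 admissible occurs = Symmetry.bijection enumeration λ {T} {U} T∼U →
        let a , a∼T = surj T
            b , b∼U = surj U
        in type-injective a b (∼-trans (type a) (proj₁ T) (type b) a∼T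
             (∼-trans (proj₁ T) (proj₁ U) (type b) T∼U (∼-sym (type b) (proj₁ U) b∼U)))
      where
      surj : (T : ∃ 𝒯) → ∃ λ a → type a ∼ proj₁ T
      surj (T , T∈𝒯) = type-surjective T (admissible T T∈𝒯)

      enumeration : Bijection (≡.setoid (Fin (count (suc n)))) (unlabelled 𝒯)
      enumeration = record
        { to        = λ a → type a , occurs (Triples.at a) (Triples.sound a)
        ; cong      = λ { {a} refl → ∼-refl (type a) }
        ; bijective = (λ {a} {b} → type-injective a b) ,
            λ T → proj₁ (surj T) , λ { refl → proj₂ (surj T) }
        }

  -- Both sets are preimages of the same set of admissible types, one under `flips o` and one under
  -- `flips o′`. The moves to reverse are therefore those on which `o` and `o′` differ.
  Admissible-EqualUpToReorientation : ∀ {q r ℓ₁ ℓ₂} (o o′ : Fin r → Bool)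
    (𝒯 : Pred (LabelledType q r) ℓ₁) (𝒰 : Pred (LabelledType q r) ℓ₂) →
    (∀ T → 𝒯 T ⇔ Admissible (flips o T)) → (∀ U → 𝒰 U ⇔ Admissible (flips o′ U)) →
    EqualUpToReorientation 𝒯 𝒰
  Admissible-EqualUpToReorientation {r = r} o o′ 𝒯 𝒰 𝒯⇔ 𝒰⇔ = tabulate both , λ U → mk⇔
    (λ U∈𝒰 → flips both U ,
      Equivalence.from (𝒯⇔ (flips both U)) (Admissible-resp (flips o′ U) (flips o (flips both U))
        (λ i j k i≢k → sym (flip-xorˡ (o j) (o′ j) (U i j k i≢k)))
        (Equivalence.to (𝒰⇔ U) U∈𝒰)) ,
      ≐-sym (≐-trans (reorient-tabulate both (flips both U)) (flips-self both U)))
    (λ (T , T∈𝒯 , U≐ST) → Equivalence.from (𝒰⇔ U) (Admissible-resp (flips o T) (flips o′ U)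
      (λ i j k i≢k → trans (sym (flip-xorʳ (o j) (o′ j) (T i j k i≢k)))
        (cong (flip (o′ j)) (sym (trans (U≐ST i j k i≢k) (reorient-tabulate both T i j k i≢k)))))
      (Equivalence.to (𝒯⇔ T) T∈𝒯)))
    where
    both : Fin r → Bool
    both j = o j xor o′ j

-- Ordered fields

module IntegerRingSolver {c ℓ} (R : CommutativeRing c ℓ) where
  open CommutativeRing R
  open Algebra.Properties.Ring ring
  open Algebra.Properties.AbelianGroup +-abelianGroup using (⁻¹-∙-comm)
  open Algebra.Properties.Semiring.Mult semiring
    using (×-homo-+; ×1-homo-*) renaming (_×_ to _·_)
  open import Relation.Binary.Reasoning.Setoid setoid

  -- The canonical ring homomorphism. With its help the solver calculates with integer coefficients,
  -- whose equality is decidable, and so recognises terms that cancel.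
  ι : ℤ → Carrier
  ι (+ n)    = n · 1#
  ι -[1+ n ] = - (suc n · 1#)

  ι-neg : ∀ n → ι (ℤ.- n) ≈ - ι n
  ι-neg (+ zero)   = sym -0#≈0#
  ι-neg (+ suc n)  = refl
  ι-neg (-[1+ n ]) = sym (-‿involutive _)

  ι-⊖ : ∀ m n → ι (m ⊖ n) ≈ m · 1# - n · 1#
  ι-⊖ m       zero    = sym (trans (+-congˡ -0#≈0#) (+-identityʳ _))
  ι-⊖ zero    (suc n) = sym (+-identityˡ _)
  ι-⊖ (suc m) (suc n) = begin
    ι (suc m ⊖ suc n)                        ≡⟨ ≡.cong ι (ℤ.[1+m]⊖[1+n]≡m⊖n m n) ⟩
    ι (m ⊖ n)                                ≈⟨ ι-⊖ m n ⟩
    m · 1# - n · 1#                          ≈⟨ +-identityˡ _ ⟨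
    0# + (m · 1# - n · 1#)                   ≈⟨ +-congʳ (-‿inverseʳ 1#) ⟨
    (1# - 1#) + (m · 1# - n · 1#)            ≈⟨ +-assoc _ _ _ ⟩
    1# + (- 1# + (m · 1# - n · 1#))          ≈⟨ +-congˡ (+-assoc _ _ _) ⟨
    1# + ((- 1# + m · 1#) - n · 1#)          ≈⟨ +-congˡ (+-congʳ (+-comm _ _)) ⟩
    1# + ((m · 1# - 1#) - n · 1#)            ≈⟨ +-congˡ (+-assoc _ _ _) ⟩
    1# + (m · 1# + (- 1# - n · 1#))          ≈⟨ +-assoc _ _ _ ⟨
    (1# + m · 1#) + (- 1# - n · 1#)          ≈⟨ +-congˡ (⁻¹-∙-comm _ _) ⟩
    suc m · 1# - suc n · 1#                  ∎

  ι-+ : ∀ m n → ι (m ℤ.+ n) ≈ ι m + ι n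
  ι-+ (+ m)    (+ n)    = ×-homo-+ 1# m n
  ι-+ (+ m)    -[1+ n ] = ι-⊖ m (suc n)
  ι-+ -[1+ m ] (+ n)    = trans (ι-⊖ n (suc m)) (+-comm _ _)
  ι-+ -[1+ m ] -[1+ n ] = trans
    (-‿cong (trans (reflexive (≡.cong (λ k → suc k · 1#) (≡.sym (ℕ.+-suc m n))))
                   (×-homo-+ 1# (suc m) (suc n))))
    (sym (⁻¹-∙-comm _ _))

  ι-*⁺ : ∀ m n → ι (+ m ℤ.* n) ≈ m · 1# * ι n
  ι-*⁺ zero    n = trans (reflexive (≡.cong ι (ℤ.*-zeroˡ n))) (sym (zeroˡ _))
  ι-*⁺ (suc m) n = begin
    ι (+ suc m ℤ.* n)         ≡⟨ ≡.cong ι (ℤ.suc-* (+ m) n) ⟩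
    ι (n ℤ.+ + m ℤ.* n)       ≈⟨ ι-+ n (+ m ℤ.* n) ⟩
    ι n + ι (+ m ℤ.* n)       ≈⟨ +-cong (sym (*-identityˡ _)) (ι-*⁺ m n) ⟩
    1# * ι n + m · 1# * ι n   ≈⟨ distribʳ _ _ _ ⟨
    suc m · 1# * ι n          ∎

  ι-* : ∀ m n → ι (m ℤ.* n) ≈ ι m * ι n
  ι-* (+ m)    n = ι-*⁺ m n
  ι-* -[1+ m ] n = begin
    ι (-[1+ m ] ℤ.* n)          ≡⟨ ≡.cong ι (ℤ.neg-distribˡ-* (+ suc m) n) ⟨
    ι (ℤ.- (+ suc m ℤ.* n))     ≈⟨ ι-neg (+ suc m ℤ.* n) ⟩
    - ι (+ suc m ℤ.* n)         ≈⟨ -‿cong (ι-*⁺ (suc m) n) ⟩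
    - (suc m · 1# * ι n)        ≈⟨ -‿distribˡ-* _ _ ⟩
    ι -[1+ m ] * ι n            ∎

  ℤ-rawRing : RawRing _ _
  ℤ-rawRing = record
    { _≈_ = _≡_ ; _+_ = ℤ._+_ ; _*_ = ℤ._*_ ; -_ = ℤ.-_ ; 0# = ℤ.0ℤ ; 1# = ℤ.1ℤ }

  ι-morphism : ℤ-rawRing -Raw-AlmostCommutative⟶ fromCommutativeRing R
  ι-morphism = record
    { ⟦_⟧ = ι ; +-homo = ι-+ ; *-homo = ι-* ; -‿homo = ι-neg
    ; 0-homo = refl ; 1-homo = +-identityʳ 1# }

  ι-≟ : ∀ m n → Maybe (ι m ≈ ι n)
  ι-≟ m n with m ℤ.≟ n
  ... | yes m≡n = just (reflexive (≡.cong ι m≡n))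
  ... | no _    = nothing

  open Algebra.Solver.Ring ℤ-rawRing (fromCommutativeRing R) ι-morphism ι-≟ public
    using (solve; _:=_; _:+_; _:*_; _:-_; :-_; con; Polynomial)

module OrderedField {c ℓ₁ ℓ₂} (ℝ : CompleteOrderedField c ℓ₁ ℓ₂) where
  open CompleteOrderedField ℝ hiding (zero)
  open IsStrictTotalOrder isStrictTotalOrder public
    using (compare; _<?_; <-respʳ-≈; <-respˡ-≈)
    renaming (trans to <-trans; irrefl to <-irrefl; asym to <-asym)
  open IntegerRingSolver commutativeRing public
    using (solve; _:=_; _:+_; _:*_; _:-_; :-_; Polynomial)
  open Plane ℝ

  pos-resp : ∀ {x y} → x ≈ y → 0# < x → 0# < y
  pos-resp = <-respʳ-≈

  <⇒pos : ∀ {x y} → x < y → 0# < y - x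
  <⇒pos {x} x<y = <-respˡ-≈ (-‿inverseʳ x) (+-monoˡ-< (- x) x<y)

  pos⇒< : ∀ {x y} → 0# < y - x → x < y
  pos⇒< {x} {y} p = <-respʳ-≈ (solve 2 (λ x y → y :- x :+ x := y) refl x y)
    (<-respˡ-≈ (+-identityˡ x) (+-monoˡ-< x p))

  +-pos : ∀ {x y} → 0# < x → 0# < y → 0# < x + y
  +-pos {y = y} 0<x 0<y = <-trans 0<y (<-respˡ-≈ (+-identityˡ y) (+-monoˡ-< y 0<x))

  0≤⇒pos⊎≈0 : ∀ {x} → 0# ≤ x → 0# < x ⊎ 0# ≈ x
  0≤⇒pos⊎≈0 {x} 0≤x with compare 0# x
  ... | tri< 0<x _ _ = inj₁ 0<x
  ... | tri≈ _ 0≈x _ = inj₂ 0≈x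
  ... | tri> _ _ x<0 = ⊥-elim (0≤x x<0)

  pos⇒0≤ : ∀ {x} → 0# < x → 0# ≤ x
  pos⇒0≤ 0<x x<0 = <-asym 0<x x<0

  +-pos-0≤ : ∀ {x y} → 0# < x → 0# ≤ y → 0# < x + y
  +-pos-0≤ 0<x 0≤y with 0≤⇒pos⊎≈0 0≤y
  ... | inj₁ 0<y = +-pos 0<x 0<y
  ... | inj₂ 0≈y = pos-resp (trans (sym (+-identityʳ _)) (+-congˡ 0≈y)) 0<x

  +-0≤-pos : ∀ {x y} → 0# ≤ x → 0# < y → 0# < x + y
  +-0≤-pos 0≤x 0<y = pos-resp (+-comm _ _) (+-pos-0≤ 0<y 0≤x)

  *-pos-0≤ : ∀ {x y} → 0# < x → 0# ≤ y → 0# ≤ x * y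
  *-pos-0≤ 0<x 0≤y with 0≤⇒pos⊎≈0 0≤y
  ... | inj₁ 0<y = pos⇒0≤ (*-pos 0<x 0<y)
  ... | inj₂ 0≈y = <-irrefl (trans (*-congˡ (sym 0≈y)) (zeroʳ _))

  neg⇒pos : ∀ {x} → x < 0# → 0# < - x
  neg⇒pos x<0 = pos-resp (+-identityˡ _) (<⇒pos x<0)

  pos⇒neg : ∀ {x} → 0# < - x → x < 0#
  pos⇒neg 0<-x = pos⇒< (pos-resp (sym (+-identityˡ _)) 0<-x)

  pos⇒-neg : ∀ {x} → 0# < x → - x < 0#
  pos⇒-neg {x} 0<x = pos⇒neg (pos-resp (solve 1 (λ x → x := :- :- x) refl x) 0<x)

  *-cancelˡ-pos : ∀ {x y} → 0# < x → 0# < x * y → 0# < y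
  *-cancelˡ-pos {x} {y} 0<x 0<xy with compare 0# y
  ... | tri< 0<y _ _ = 0<y
  ... | tri≈ _ 0≈y _ = ⊥-elim (<-irrefl (trans (sym (zeroʳ x)) (*-congˡ 0≈y)) 0<xy)
  ... | tri> _ _ y<0 = ⊥-elim (<-asym 0<xy
    (pos⇒neg (pos-resp (solve 2 (λ x y → x :* (:- y) := :- (x :* y)) refl x y)
      (*-pos 0<x (neg⇒pos y<0)))))

  square-0≤ : ∀ x → 0# ≤ x * x
  square-0≤ x with compare 0# x
  ... | tri< 0<x _ _ = pos⇒0≤ (*-pos 0<x 0<x)
  ... | tri≈ _ 0≈x _ = <-irrefl (trans (*-congˡ (sym 0≈x)) (zeroʳ x))
  ... | tri> _ _ x<0 = pos⇒0≤ (pos-resp (solve 1 (λ x → (:- x) :* (:- x) := x :* x) refl x)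
    (*-pos (neg⇒pos x<0) (neg⇒pos x<0)))

  square-pos : ∀ {x} → ¬ x ≈ 0# → 0# < x * x
  square-pos {x} x≉0 with compare 0# x
  ... | tri< 0<x _ _ = *-pos 0<x 0<x
  ... | tri≈ _ 0≈x _ = ⊥-elim (x≉0 (sym 0≈x))
  ... | tri> _ _ x<0 = pos-resp (solve 1 (λ x → (:- x) :* (:- x) := x :* x) refl x)
    (*-pos (neg⇒pos x<0) (neg⇒pos x<0))

  pos⇒≉0 : ∀ {x} → 0# < x → ¬ x ≈ 0#
  pos⇒≉0 0<x x≈0 = <-irrefl (sym x≈0) 0<x

  pos-inverse : ∀ {x} → 0# < x → ∃ λ y → 0# < y × x * y ≈ 1#
  pos-inverse {x} 0<x with inverse x (pos⇒≉0 0<x)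
  ... | y , xy≈1 = y , *-cancelˡ-pos 0<x (pos-resp (sym xy≈1) 0<1) , xy≈1

  2# : Carrier
  2# = 1# + 1#

  0<2 : 0# < 2#
  0<2 = +-pos 0<1 0<1

  pos-half : ∀ {x} → 0# < x → ∃ λ h → 0# < h × h + h ≈ x
  pos-half {x} 0<x with pos-inverse 0<2
  ... | y , 0<y , 2y≈1 = x * y , *-pos 0<x 0<y ,
    trans (trans (trans (sym (distribˡ x y y))
      (*-congˡ (trans (+-cong (sym (*-identityˡ y)) (sym (*-identityˡ y))) (sym (distribʳ y 1# 1#)))))
      (*-congˡ 2y≈1)) (*-identityʳ x)

  -- x ◁ b says that ∣x∣ < b.
  infix 4 _◁_
  _◁_ : Carrier → Carrier → Set ℓ₂
  x ◁ b = 0# < b + x × 0# < b - x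

  ◁-resp : ∀ {x y b} → x ≈ y → x ◁ b → y ◁ b
  ◁-resp x≈y (p , q) = pos-resp (+-congˡ x≈y) p , pos-resp (+-congˡ (-‿cong x≈y)) q

  ◁-bound : ∀ x → ∃ λ b → x ◁ b
  ◁-bound x with compare 0# x
  ... | tri< 0<x _ _ = x + 1# , +-pos (+-pos 0<x 0<1) 0<x ,
    pos-resp (sym (solve 2 (λ x o → x :+ o :- x := o) refl x 1#)) 0<1
  ... | tri≈ _ 0≈x _ = 1# , pos-resp (trans (sym (+-identityʳ 1#)) (+-congˡ 0≈x)) 0<1 ,
    pos-resp (trans (solve 2 (λ x o → o := x :+ (o :- x))
        refl x 1#) (trans (+-congʳ (sym 0≈x)) (+-identityˡ _))) 0<1
  ... | tri> _ _ x<0 = - x + 1# ,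
    pos-resp (sym (solve 2 (λ x o → :- x :+ o :+ x := o) refl x 1#)) 0<1 ,
    +-pos (+-pos (neg⇒pos x<0) 0<1) (neg⇒pos x<0)

  ◁-+ : ∀ {x y b d} → x ◁ b → y ◁ d → x + y ◁ b + d
  ◁-+ {x} {y} {b} {d} (p , q) (p′ , q′) =
    pos-resp (solve 4 (λ x y b d → (b :+ x) :+ (d :+ y) := b :+ d :+ (x :+ y))
        refl x y b d) (+-pos p p′) ,
    pos-resp (solve 4 (λ x y b d → (b :- x) :+ (d :- y) := b :+ d :- (x :+ y))
        refl x y b d) (+-pos q q′)

  ◁-neg : ∀ {x b} → x ◁ b → - x ◁ b
  ◁-neg {x} {b} (p , q) = q , pos-resp (solve 2 (λ x b → b :+ x := b :- (:- x)) refl x b) p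

  pos-double⁻¹ : ∀ {x} → 0# < x + x → 0# < x
  pos-double⁻¹ {x} p = *-cancelˡ-pos 0<2
    (pos-resp (trans (+-cong (sym (*-identityˡ x)) (sym (*-identityˡ x))) (sym (distribʳ x 1# 1#))) p)

  ◁⇒pos : ∀ {x b} → x ◁ b → 0# < b
  ◁⇒pos {x} {b} (p , q) = pos-double⁻¹
    (pos-resp (solve 2 (λ x b → (b :+ x) :+ (b :- x) := b :+ b) refl x b) (+-pos p q))

  -- The factors `b ± x` and `d ± y` are positive. Adding two of their products cancels the mixed
  -- terms and leaves twice `b * d + x * y`, or twice `b * d - x * y`.
  ◁-* : ∀ {x y b d} → x ◁ b → y ◁ d → x * y ◁ b * d
  ◁-* {x} {y} {b} {d} (p , q) (p′ , q′) =
    pos-double⁻¹ (pos-resp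
      (solve 4 (λ x y b d → (b :+ x) :* (d :+ y) :+ (b :- x) :* (d :- y)
        := (b :* d :+ x :* y) :+ (b :* d :+ x :* y))
          refl x y b d)
      (+-pos (*-pos p p′) (*-pos q q′))) ,
    pos-double⁻¹ (pos-resp
      (solve 4 (λ x y b d → (b :+ x) :* (d :- y) :+ (b :- x) :* (d :+ y)
        := (b :* d :- x :* y) :+ (b :* d :- x :* y))
          refl x y b d)
      (+-pos (*-pos p q′) (*-pos q p′)))

  ◁-weaken : ∀ {x b d} → b < d → x ◁ b → x ◁ d
  ◁-weaken {x} {b} {d} b<d (p , q) =
    pos-resp (solve 3 (λ x b d → (d :- b) :+ (b :+ x) := d :+ x) refl x b d) (+-pos (<⇒pos b<d) p) ,
    pos-resp (solve 3 (λ x b d → (d :- b) :+ (b :- x) := d :- x) refl x b d) (+-pos (<⇒pos b<d) q)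

  ◁-square : ∀ {x b} → x ◁ b → x * x < b * b
  ◁-square {x} {b} (p , q) = pos⇒< (pos-resp
    (solve 2 (λ x b → (b :+ x) :* (b :- x) := b :* b :- x :* x) refl x b) (*-pos p q))

  square-<⇒< : ∀ {x b} → 0# < b → x * x < b * b → x < b
  square-<⇒< {x} {b} 0<b x²<b² with compare x b
  ... | tri< x<b _ _ = x<b
  ... | tri≈ _ x≈b _ = ⊥-elim (<-irrefl (*-cong x≈b x≈b) x²<b²)
  ... | tri> _ _ b<x = ⊥-elim (<-asym x²<b² (pos⇒< (pos-resp
    (solve 2 (λ x b → (x :- b) :* (x :+ b) := x :* x :- b :* b) refl x b)
    (*-pos (<⇒pos b<x) (+-pos (<-trans 0<b b<x) 0<b)))))

  square-◁ : ∀ {x b} → 0# < b → x * x < b * b → x ◁ b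
  square-◁ {x} {b} 0<b x²<b² =
    pos-resp (solve 2 (λ x b → b :- (:- x) := b :+ x) refl x b) (<⇒pos (square-<⇒< 0<b
      (<-respˡ-≈ (solve 1 (λ x → x :* x := (:- x) :* (:- x)) refl x) x²<b²))) ,
    <⇒pos (square-<⇒< 0<b x²<b²)

  -- Being closed under finite conjunctions, this lets one large scalar meet finitely many
  -- requirements at once.
  Eventually : ∀ {a} → (Carrier → Set a) → Set (a ⊔ c ⊔ ℓ₂)
  Eventually Q = ∃ λ K₀ → ∀ K → K₀ < K → Q K

  ev-map : ∀ {a b} {Q : Carrier → Set a} {R : Carrier → Set b} →
           (∀ {K} → Q K → R K) → Eventually Q → Eventually R
  ev-map f (K₀ , h) = K₀ , λ K K₀<K → f (h K K₀<K)

  ev-× : ∀ {a b} {Q : Carrier → Set a} {R : Carrier → Set b} →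
         Eventually Q → Eventually R → Eventually (λ K → Q K × R K)
  ev-× (K₁ , h₁) (K₂ , h₂) with compare K₁ K₂
  ... | tri< K₁<K₂ _ _ = K₂ , λ K p → h₁ K (<-trans K₁<K₂ p) , h₂ K p
  ... | tri≈ _ K₁≈K₂ _ = K₂ , λ K p → h₁ K (<-respˡ-≈ (sym K₁≈K₂) p) , h₂ K p
  ... | tri> _ _ K₂<K₁ = K₁ , λ K p → h₁ K p , h₂ K (<-trans K₂<K₁ p)

  ev-Fin : ∀ {a n} {Q : Fin n → Carrier → Set a} →
           (∀ i → Eventually (Q i)) → Eventually (λ K → ∀ i → Q i K)
  ev-Fin {n = zero}  h = 0# , λ _ _ ()
  ev-Fin {n = suc n} h = ev-map (λ { (q , qs) zero → q ; (q , qs) (suc i) → qs i })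
    (ev-× (h zero) (ev-Fin (h ∘ suc)))

  ev-linear : ∀ {d} → 0# < d → ∀ b → Eventually (λ K → b < K * d)
  ev-linear {d} 0<d b with pos-inverse 0<d
  ... | d⁻¹ , _ , dd⁻¹≈1 = b * d⁻¹ , λ K p → pos⇒< (pos-resp
    (trans (solve 4 (λ K b d e → (K :- b :* e) :* d := K :* d :- b :* (d :* e)) refl K b d d⁻¹)
      (+-congˡ (-‿cong (trans (*-congˡ dd⁻¹≈1) (*-identityʳ b)))))
    (*-pos (<⇒pos p) 0<d))

  -- The Archimedean property from completeness. Let `s` be the supremum of the naturals that are at
  -- most `x`. Some such `n` exceeds `s - 1#`; its successor exceeds `s`, so it is not among them.
  floor-ℕ : ∀ x → 0# ≤ x → ∃ λ n → fromℕ n ≤ x × x < fromℕ (suc n)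
  floor-ℕ x 0≤x with complete
      (λ y → Lift c (∃ λ n → y ≈ fromℕ n × fromℕ n ≤ x))
      (0# , lift (0 , refl , 0≤x))
      (x , λ { y (lift (n , y≈n , n≤x)) x<y → n≤x (<-respʳ-≈ y≈n x<y) })
  ... | s , upper , least with least (s - 1#) (pos⇒< (pos-resp
          (solve 2 (λ s o → o := s :- (s :- o)) refl s 1#) 0<1))
  ...   | y , lift (n , y≈n , n≤x) , s-1<y with x <? fromℕ (suc n)
  ...     | yes x<1+n = n , n≤x , x<1+n
  ...     | no  1+n≤x = ⊥-elim (upper (fromℕ (suc n)) (lift (suc n , refl , 1+n≤x))
              (pos⇒< (pos-resp (trans (solve 3 (λ s o y → y :- (s :- o) := (o :+ y) :- s)
                  refl s 1# y)
                 (+-congʳ (+-congˡ y≈n))) (<⇒pos s-1<y))))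

  floor-error : ∀ {x} n → fromℕ n ≤ x → x < fromℕ (suc n) → fromℕ n - x ◁ 2#
  floor-error {x} n n≤x x<1+n =
    pos-resp (solve 3 (λ x n o → o :+ ((o :+ n) :- x) := (o :+ o) :+ (n :- x)) refl x (fromℕ n) 1#)
      (+-pos 0<1 (<⇒pos x<1+n)) ,
    pos-resp (solve 3 (λ x n o → (o :+ o) :+ (x :- n) := (o :+ o) :- (n :- x)) refl x (fromℕ n) 1#)
      (+-pos-0≤ 0<2 λ x-n<0 → n≤x (pos⇒< (pos-resp
        (solve 2 (λ x n → :- (x :- n) := n :- x) refl x (fromℕ n)) (neg⇒pos x-n<0))))

  fromℤ-neg : ∀ n → fromℤ (ℤ.- + n) ≈ - fromℕ n
  fromℤ-neg zero    = IntegerRingSolver.ι-neg commutativeRing (+ zero)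
  fromℤ-neg (suc n) = refl

  round : ∀ x → ∃ λ z → fromℤ z - x ◁ 2#
  round x with x <? 0#
  ... | no 0≤x = let n , n≤x , x<1+n = floor-ℕ x 0≤x in + n , floor-error n n≤x x<1+n
  ... | yes x<0 = let n , n≤-x , -x<1+n = floor-ℕ (- x) (pos⇒0≤ (neg⇒pos x<0)) in
    ℤ.- + n , ◁-resp
      (trans (solve 2 (λ x n → :- (n :- (:- x)) := (:- n) :- x) refl x (fromℕ n))
             (+-congʳ (sym (fromℤ-neg n))))
      (◁-neg (floor-error n n≤-x -x<1+n))

  -- The form of the conclusion fits the working board of order `n`, which is dilated by the factor
  -- `suc n`.
  ev-ℕ : ∀ {a} {Q : Carrier → Set a} → Eventually Q → ∃ λ n → 1 ℕ.≤ n × Q (fromℕ (suc n))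
  ev-ℕ {Q = Q} (K₀ , h) with K₀ <? 0#
  ... | yes K₀<0 = 1 , s≤s z≤n , h _ (<-trans K₀<0 (+-pos 0<1 (pos-resp (sym (+-identityʳ 1#)) 0<1)))
  ... | no 0≤K₀ = let n , _ , K₀<1+n = floor-ℕ K₀ 0≤K₀ in suc n , s≤s z≤n ,
    h _ (<-trans K₀<1+n (pos⇒< (pos-resp
      (solve 2 (λ n o → o := (o :+ (o :+ n)) :- (o :+ n)) refl (fromℕ n) 1#) 0<1)))

-- From real points to lattice points of the board

module Realisation {c ℓ₁ ℓ₂} (ℝ : CompleteOrderedField c ℓ₁ ℓ₂) where
  open CompleteOrderedField ℝ hiding (zero)
  open OrderedField ℝ
  open Plane ℝ

  infix 4 _◁₂_
  _◁₂_ : ℝ² → Carrier → Set ℓ₂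
  (x , y) ◁₂ b = x ◁ b × y ◁ b

  detᵖ : ∀ {n} → Polynomial n × Polynomial n → Polynomial n × Polynomial n → Polynomial n
  detᵖ (a , b) (x , y) = a :* y :- b :* x

  det-◁ : ∀ m d → ∃ λ b → ∀ {v} → v ◁₂ d → det m v ◁ b
  det-◁ (m₁ , m₂) d = let b₁ , m₁◁b₁ = ◁-bound m₁ ; b₂ , m₂◁b₂ = ◁-bound m₂ in
    b₁ * d + b₂ * d , λ (x◁d , y◁d) → ◁-+ (◁-* m₁◁b₁ y◁d) (◁-neg (◁-* m₂◁b₂ x◁d))

  -- Write `det m w` as `K * det m v` plus the determinant of `m` with the error `w − K ∙ v`. The
  -- latter is bounded in terms of `m` and `d` alone, and the former outgrows the bound.
  ev-det-pos : ∀ m v d → 0# < det m v →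
    Eventually λ K → ∀ w → (w − K ∙ v) ◁₂ d → 0# < det m w
  ev-det-pos m@(m₁ , m₂) v@(v₁ , v₂) d 0<mv = let b , bounded = det-◁ m d in
    ev-map (λ {K} b<Kmv w@(w₁ , w₂) w-Kv◁d → pos-resp
      (solve 8 (λ b K m₁ m₂ v₁ v₂ w₁ w₂ →
         let m = (m₁ , m₂) ; v = (v₁ , v₂) in
         (K :* detᵖ m v :- b) :+ (b :+ detᵖ m (w₁ :- K :* v₁ , w₂ :- K :* v₂))
           := detᵖ m (w₁ , w₂))
         refl b K m₁ m₂ v₁ v₂ w₁ w₂)
      (+-pos (<⇒pos b<Kmv) (proj₁ (bounded w-Kv◁d))))
    (ev-linear 0<mv b)

  -₂_ : ℝ² → ℝ²
  -₂ (x , y) = - x , - y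

  det-negˡ : ∀ m v → det (-₂ m) v ≈ - det m v
  det-negˡ (m₁ , m₂) (x , y) = solve 4 (λ m₁ m₂ x y →
    detᵖ (:- m₁ , :- m₂) (x , y) := :- detᵖ (m₁ , m₂) (x , y)) refl m₁ m₂ x y

  -- Take `η` to be a quarter of the radius `ε`, so `h` is half of it. A point of the `η`-ball
  -- around a point of the box differs from the centre by less than `h` in each coordinate. The sum
  -- of squares is then below `h * h + h * h`, hence below `ε * ε`.
  Interior-box : ∀ {a} {A : ℝ² → Set a} ((p , _) : ∃ (Interior A)) →
    ∃ λ b → 0# < b × (∀ p′ → (p′ − p) ◁₂ b → Interior A p′)
  Interior-box {A = A} ((x , y) , ε , 0<ε , ball) with pos-half 0<ε
  ... | h , 0<h , 2h≈ε with pos-half 0<h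
  ...   | η , 0<η , 2η≈h = η , 0<η , λ (x′ , y′) (x′◁ , y′◁) → η , 0<η , λ x″ y″ near →
    let x″◁ = square-◁ 0<η (pos⇒< (pos-resp
                (solve 3 (λ s t e → (e :- (s :+ t)) :+ t := e :- s)
                    refl ((x″ - x′) * (x″ - x′)) ((y″ - y′) * (y″ - y′)) (η * η))
                (+-pos-0≤ (<⇒pos near) (square-0≤ (y″ - y′)))))
        y″◁ = square-◁ 0<η (pos⇒< (pos-resp
                (solve 3 (λ s t e → (e :- (s :+ t)) :+ s := e :- t)
                    refl ((x″ - x′) * (x″ - x′)) ((y″ - y′) * (y″ - y′)) (η * η))
                (+-pos-0≤ (<⇒pos near) (square-0≤ (x″ - x′)))))
    in ball x″ y″ (pos⇒< (pos-resp
      (trans (solve 3 (λ s t h → ((h :* h :- s) :+ (h :* h :- t)) :+ (h :* h :+ h :* h)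
          := (h :+ h) :* (h :+ h) :- (s :+ t))
        refl ((x″ - x) * (x″ - x)) ((y″ - y) * (y″ - y)) h) (+-congʳ (*-cong 2h≈ε 2h≈ε)))
      (+-pos (+-pos (within x x′ x″ x′◁ x″◁) (within y y′ y″ y′◁ y″◁))
        (+-pos (*-pos 0<h 0<h) (*-pos 0<h 0<h)))))
    where
    within : ∀ s s′ s″ → s′ - s ◁ η → s″ - s′ ◁ η → 0# < h * h - (s″ - s) * (s″ - s)
    within s s′ s″ p q = <⇒pos (◁-square (pos-resp (+-congʳ 2η≈h) (proj₁ r) , pos-resp (+-congʳ 2η≈h) (proj₂ r)))
      where
      r = ◁-resp (solve 3 (λ s s′ s″ → (s″ :- s′) :+ (s′ :- s) := s″ :- s) refl s s′ s″) (◁-+ q p)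

  round₂ : ∀ v → ∃ λ z → (fromℤ² z − v) ◁₂ 2#
  round₂ (x , y) = let z , z◁ = round x ; w , w◁ = round y in (z , w) , z◁ , w◁

  -- Scaling and translating the configuration by K and N p, with K and then
  -- N large, absorbs the rounding errors and brings it into the board.
  HasType⇒Types : ∀ {q r} (P : Rider r) (B : Board) (p : Fin q → ℝ²) T →
                  HasType P p T → Types P q B T
  HasType⇒Types {q} {r} P B p T hasType = result
    where
    open Rider P
    -- The error of a difference of two rounded points, each with error `2#` in every coordinate.
    4# = 2# + 2#

    centre : ℝ²
    centre = proj₁ (Board.nonempty-interior B)

    OnSide-stable : ∀ s m v → OnSide P s m v →
      Eventually λ K → ∀ w → (w − K ∙ v) ◁₂ 4# → OnSide P s m w
    OnSide-stable left  m v h = ev-det-pos m v 4# h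
    OnSide-stable right m v h = ev-map (λ f w d → pos⇒neg (pos-resp (det-negˡ m w) (f w d)))
      (ev-det-pos (-₂ m) v 4# (pos-resp (sym (det-negˡ m v)) (neg⇒pos h)))

    Stable : Fin q → Fin r → Fin q → Carrier → Set _
    Stable i j k K = ∀ (i≢k : i ≢ k) w → (w − K ∙ (p k − p i)) ◁₂ 4# →
      OnSide P (T i j k i≢k) (move j) w

    stable : ∀ i j k → Eventually (Stable i j k)
    -- The scale has to be chosen before a proof of `i ≢ k` is given, so equality of the labels is
    -- decided here. For equal labels the condition is vacuous.
    stable i j k with i Fin.≟ k
    ... | yes i≡k = 0# , λ _ _ i≢k → ⊥-elim (i≢k i≡k)
    ... | no i≢k  = ev-map (λ f _ → f) (OnSide-stable (T i j k i≢k) (move j) _ (hasType i j k i≢k))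

    stable-K : ∃ λ K → ∀ i j k → Stable i j k K
    stable-K = let K₀ , h = ev-Fin λ i → ev-Fin λ j → ev-Fin λ k → stable i j k in
      K₀ + 1# , h _ (pos⇒< (pos-resp (solve 2 (λ a b → b := (a :+ b) :- a) refl K₀ 1#) 0<1))

    K = proj₁ stable-K

    target : Carrier → Fin q → ℝ²
    target N i = N * proj₁ centre + K * proj₁ (p i) , N * proj₂ centre + K * proj₂ (p i)

    config : Carrier → Fin q → ℤ × ℤ
    config N i = proj₁ (round₂ (target N i))

    config-error : ∀ N i → (fromℤ² (config N i) − target N i) ◁₂ 2#
    config-error N i = proj₂ (round₂ (target N i))

    -- The translation `a` cancels in the difference, so the type is independent of `N`, which can
    -- be chosen after `K`.
    difference-error : ∀ a x y s t → s - (a + K * x) ◁ 2# → t - (a + K * y) ◁ 2# →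
      (t - s) - K * (y - x) ◁ 4#
    difference-error a x y s t s◁ t◁ = ◁-resp
      (solve 6 (λ a K x y s t → (t :- (a :+ K :* y)) :+ (:- (s :- (a :+ K :* x)))
        := (t :- s) :- K :* (y :- x)) refl a K x y s t)
      (◁-+ t◁ (◁-neg s◁))

    config-hasType : ∀ N → HasType P (fromℤ² ∘ config N) T
    config-hasType N i j k i≢k = proj₂ stable-K i j k i≢k _
      ( difference-error _ _ _ _ _ (proj₁ (config-error N i)) (proj₁ (config-error N k))
      , difference-error _ _ _ _ _ (proj₂ (config-error N i)) (proj₂ (config-error N k)))

    box = Interior-box (Board.nonempty-interior B)
    η = proj₁ box

    offset-bound : ∀ (v : ℝ²) → ∃ λ b → proj₁ v ◁ b × proj₂ v ◁ b
    offset-bound (x , y) = let b , x◁b = ◁-bound x ; d , y◁d = ◁-bound y in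
      b + d , ◁-weaken (pos⇒< (pos-resp (solve 2 (λ b d → d := (b :+ d) :- b)
          refl b d) (◁⇒pos y◁d))) x◁b ,
      ◁-weaken (pos⇒< (pos-resp (solve 2 (λ b d → b := (b :+ d) :- d) refl b d) (◁⇒pos x◁b))) y◁d

    bound : Fin q → Carrier
    bound i = 2# + proj₁ (offset-bound (K ∙ p i))

    -- The dilated box around the centre must hold each offset `K ∙ p i` together with its rounding
    -- error. The last condition records that the dilation factor is positive.
    small : ∃ λ n → 1 ℕ.≤ n ×
      ((∀ i → bound i < fromℕ (suc n) * η) × 0# < fromℕ (suc n) * 1#)
    small = ev-ℕ (ev-× (ev-Fin λ i → ev-linear (proj₁ (proj₂ box)) (bound i)) (ev-linear 0<1 0#))

    n = proj₁ small
    N = fromℕ (suc n)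

    0<N : 0# < N
    0<N = pos-resp (*-identityʳ N) (proj₂ (proj₂ (proj₂ small)))

    N⁻¹ = proj₁ (pos-inverse 0<N)

    NN⁻¹≈1 : N * N⁻¹ ≈ 1#
    NN⁻¹≈1 = proj₂ (proj₂ (pos-inverse 0<N))

    shrink : ∀ {x b} → x ◁ b → b < N * η → N⁻¹ * x ◁ η
    shrink {x} {b} x◁b b<Nη = let lo , hi = ◁-weaken b<Nη x◁b in
      pos-resp (trans (solve 4 (λ N I e x → I :* (N :* e :+ x) := (N :* I) :* e :+ I :* x)
          refl N N⁻¹ η x) (+-congʳ N⁻¹Nη))
        (*-pos 0<N⁻¹ lo) ,
      pos-resp (trans (solve 4 (λ N I e x → I :* (N :* e :- x) := (N :* I) :* e :- I :* x)
          refl N N⁻¹ η x) (+-congʳ N⁻¹Nη))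
        (*-pos 0<N⁻¹ hi)
      where
      0<N⁻¹ = proj₁ (proj₂ (pos-inverse 0<N))
      N⁻¹Nη = trans (*-congʳ NN⁻¹≈1) (*-identityˡ η)

    near-centre : ∀ x y z b → z - (N * x + K * y) ◁ 2# → K * y ◁ b → 2# + b < N * η →
      N⁻¹ * z - x ◁ η
    near-centre x y z b z◁ Ky◁ small = ◁-resp
      (trans (solve 6 (λ N I K x y z → I :* ((z :- (N :* x :+ K :* y)) :+ K :* y) := I :* z :- (N :* I) :* x)
          refl N N⁻¹ K x y z)
        (+-congˡ (-‿cong (trans (*-congʳ NN⁻¹≈1) (*-identityˡ x)))))
      (shrink (◁-+ z◁ Ky◁) small)

    N∙N⁻¹∙_ : ∀ z → z ≈ N * (N⁻¹ * z)
    N∙N⁻¹∙ z = sym (trans (sym (*-assoc _ _ _)) (trans (*-congʳ NN⁻¹≈1) (*-identityˡ z)))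

    on-board : ∀ i → WorkingBoard B n (config N i)
    on-board i = N⁻¹ ∙ fromℤ² (config N i) ,
      proj₂ (proj₂ box) _
        ( near-centre _ _ _ _ (proj₁ (config-error N i))
            (proj₁ (proj₂ (offset-bound (K ∙ p i)))) (proj₁ (proj₂ (proj₂ small)) i)
        , near-centre _ _ _ _ (proj₂ (config-error N i))
            (proj₂ (proj₂ (offset-bound (K ∙ p i)))) (proj₁ (proj₂ (proj₂ small)) i)) ,
      N∙N⁻¹∙ _ , N∙N⁻¹∙ _

    det-multiple≈0 : ∀ m {v} t → v ≈₂ t ∙ m → det m v ≈ 0#
    det-multiple≈0 (m₁ , m₂) t (e₁ , e₂) = trans (+-cong (*-congˡ e₂) (-‿cong (*-congˡ e₁)))
      (trans (solve 3 (λ a b t → a :* (t :* b) :- b :* (t :* a) := t :* (a :* b) :- t :* (a :* b))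
          refl m₁ m₂ t)
        (-‿inverseʳ _))

    OnSide⇒≉0 : ∀ s m v → OnSide P s m v → ¬ det m v ≈ 0#
    OnSide⇒≉0 left  m v 0<mv mv≈0 = <-irrefl (sym mv≈0) 0<mv
    OnSide⇒≉0 right m v mv<0 mv≈0 = <-irrefl mv≈0 mv<0

    result : Types P q B T
    result = n , proj₁ (proj₂ small) , config N , on-board ,
      -- An attacked piece lies on a move line and has determinant zero, whereas the type puts it
      -- strictly on one side.
      (λ i k i≢k (j , t , e) → OnSide⇒≉0 (T i j k i≢k) (move j) _ (config-hasType N i j k i≢k)
        (det-multiple≈0 (move j) t e)) ,
      config-hasType N

-- Sectors between consecutive move lines

module Sectors {c ℓ₁ ℓ₂} (ℝ : CompleteOrderedField c ℓ₁ ℓ₂) where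
  open CompleteOrderedField ℝ hiding (zero)
  open OrderedField ℝ
  open Counting
  open TypesOfThree
  open IntegerRingSolver commutativeRing using (con)
  open Realisation ℝ
  open Plane ℝ

  HasSign : Side → Carrier → Set ℓ₂
  HasSign left  x = 0# < x
  HasSign right x = x < 0#

  sign-unique : ∀ s s′ {x} → HasSign s x → HasSign s′ x → s ≡ s′
  sign-unique left  left  _ _ = ≡.refl
  sign-unique right right _ _ = ≡.refl
  sign-unique left  right p q = ⊥-elim (<-asym p q)
  sign-unique right left  p q = ⊥-elim (<-asym p q)

  sign-resp : ∀ s {x y} → x ≈ y → HasSign s x → HasSign s y
  sign-resp left  = <-respʳ-≈
  sign-resp right = <-respˡ-≈

  sign-neg : ∀ s {x} → HasSign s x → HasSign (opposite s) (- x)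
  sign-neg left  = pos⇒-neg
  sign-neg right = neg⇒pos

  sign-+ : ∀ s {x y} → HasSign s x → HasSign s y → HasSign s (x + y)
  sign-+ left          = +-pos
  sign-+ right {x} {y} = λ p q → pos⇒neg (pos-resp
    (solve 2 (λ x y → :- x :+ :- y := :- (x :+ y)) refl x y) (+-pos (neg⇒pos p) (neg⇒pos q)))

  sign-* : ∀ s {k x} → 0# < k → HasSign s x → HasSign s (k * x)
  sign-* left          0<k p = *-pos 0<k p
  sign-* right {k} {x} 0<k p = pos⇒neg (pos-resp
    (solve 2 (λ k x → k :* (:- x) := :- (k :* x)) refl k x) (*-pos 0<k (neg⇒pos p)))

  sign-cancel : ∀ s {k x} → 0# < k → HasSign s (k * x) → HasSign s x
  sign-cancel left          0<k p = *-cancelˡ-pos 0<k p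
  sign-cancel right {k} {x} 0<k p = pos⇒neg (*-cancelˡ-pos 0<k (pos-resp
    (solve 2 (λ k x → :- (k :* x) := k :* (:- x)) refl k x) (neg⇒pos p)))

  signed : Bool → ℝ² → ℝ²
  signed b v = if b then -₂ v else v

  sign-flip : ∀ b s m v → HasSign s (det m v) → HasSign (flip b s) (det (signed b m) v)
  sign-flip false s m v p = p
  sign-flip true  s m v p = sign-resp (opposite s) (sym (det-negˡ m v)) (sign-neg s p)

  sign-unflip : ∀ b s m v → HasSign (flip b s) (det (signed b m) v) → HasSign s (det m v)
  sign-unflip false s m v p = p
  sign-unflip true  s m v p = ≡.subst (λ s → HasSign s (det m v)) (opposite-involutive s)
    (sign-resp (opposite (opposite s))
      (trans (-‿cong (det-negˡ m v)) (solve 1 (λ x → :- :- x := x) refl (det m v)))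
      (sign-neg (opposite s) p))

  OnSide⇒sign : ∀ {r} (P : Rider r) s m v → OnSide P s m v → HasSign s (det m v)
  OnSide⇒sign P left  m v p = p
  OnSide⇒sign P right m v p = p

  sign⇒OnSide : ∀ {r} (P : Rider r) s m v → HasSign s (det m v) → OnSide P s m v
  sign⇒OnSide P left  m v p = p
  sign⇒OnSide P right m v p = p

  module _ {r} (μ : Fin r → ℝ²) where

    Typed : ∀ {q} → (Fin q → ℝ²) → LabelledType q r → Set ℓ₂
    Typed z T = ∀ i j k (i≢k : i ≢ k) → HasSign (T i j k i≢k) (det (μ j) (z k − z i))

    -- The vectors are listed counterclockwise and all fit within less than a half turn.
    Ordered : Set ℓ₂
    Ordered = ∀ {i j} → i Fin.< j → 0# < det (μ i) (μ j)

    -- Convexity of the sides in j comes from the Plücker relation, which makes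
    -- μ j₂ a positive combination of μ j₁ and μ j₃ when j₁ < j₂ < j₃.
    Typed⇒Admissible : Ordered → ∀ {q} {z : Fin q → ℝ²} {T} → Typed z T → Admissible T
    Typed⇒Admissible ordered {z = z} {T} typed = record
      { antisymmetric = λ i j k i≢k k≢i → sign-unique _ (opposite (T i j k i≢k)) (typed k j i k≢i)
          (sign-resp (opposite (T i j k i≢k)) (swap (μ j) (z i) (z k))
            (sign-neg (T i j k i≢k) (typed i j k i≢k)))
      ; convex = λ i k i≢k {j₁} {j₂} {j₃} s j₁<j₂ j₂<j₃ e₁ e₃ →
          sign-unique (T i j₂ k i≢k) s (typed i j₂ k i≢k)
            (sign-cancel s (ordered (ℕ.<-trans j₁<j₂ j₂<j₃))
              (sign-resp s (plücker (μ j₁) (μ j₂) (μ j₃) (z k − z i))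
                (sign-+ s
                  (sign-* s (ordered j₂<j₃) (≡.subst (λ s → HasSign s _) e₁ (typed i j₁ k i≢k)))
                  (sign-* s (ordered j₁<j₂) (≡.subst (λ s → HasSign s _) e₃ (typed i j₃ k i≢k))))))
      ; transitive = λ i j k l i≢k k≢l i≢l s e e′ →
          sign-unique (T i j l i≢l) s (typed i j l i≢l)
            (sign-resp s (additive (μ j) (z i) (z k) (z l))
              (sign-+ s (≡.subst (λ s → HasSign s _) e (typed i j k i≢k))
                        (≡.subst (λ s → HasSign s _) e′ (typed k j l k≢l))))
      }
      where
      swap : ∀ m a b → - det m (b − a) ≈ det m (a − b)
      swap (m₁ , m₂) (a₁ , a₂) (b₁ , b₂) = solve 6 (λ m₁ m₂ a₁ a₂ b₁ b₂ →
        :- detᵖ (m₁ , m₂) (b₁ :- a₁ , b₂ :- a₂) := detᵖ (m₁ , m₂) (a₁ :- b₁ , a₂ :- b₂))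
        refl m₁ m₂ a₁ a₂ b₁ b₂
      additive : ∀ m a b d → det m (b − a) + det m (d − b) ≈ det m (d − a)
      additive (m₁ , m₂) (a₁ , a₂) (b₁ , b₂) (d₁ , d₂) = solve 8 (λ m₁ m₂ a₁ a₂ b₁ b₂ d₁ d₂ →
        detᵖ (m₁ , m₂) (b₁ :- a₁ , b₂ :- a₂) :+ detᵖ (m₁ , m₂) (d₁ :- b₁ , d₂ :- b₂)
          := detᵖ (m₁ , m₂) (d₁ :- a₁ , d₂ :- a₂))
        refl m₁ m₂ a₁ a₂ b₁ b₂ d₁ d₂
      plücker : ∀ a b d v → det b d * det a v + det a b * det d v ≈ det a d * det b v
      plücker (a₁ , a₂) (b₁ , b₂) (d₁ , d₂) (v₁ , v₂) = solve 8 (λ a₁ a₂ b₁ b₂ d₁ d₂ v₁ v₂ →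
        let a = (a₁ , a₂) ; b = (b₁ , b₂) ; d = (d₁ , d₂) ; v = (v₁ , v₂) in
        detᵖ b d :* detᵖ a v :+ detᵖ a b :* detᵖ d v := detᵖ a d :* detᵖ b v)
        refl a₁ a₂ b₁ b₂ d₁ d₂ v₁ v₂

  det-self≈0 : ∀ v → det v v ≈ 0#
  det-self≈0 (x , y) = solve 2 (λ x y → detᵖ (x , y) (x , y) := con (+ 0)) refl x y

  det-swap : ∀ u v → det u v ≈ - det v u
  det-swap (a , b) (x , y) = solve 4 (λ a b x y → detᵖ (a , b) (x , y) := :- detᵖ (x , y) (a , b))
      refl a b x y

  comb : Carrier → ℝ² → Carrier → ℝ² → ℝ²
  comb x (e₁ , e₂) y (f₁ , f₂) = x * e₁ + y * f₁ , x * e₂ + y * f₂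

  det-comb : ∀ m x e y f → x * det m e + y * det m f ≈ det m (comb x e y f)
  det-comb (m₁ , m₂) x (e₁ , e₂) y (f₁ , f₂) = solve 8 (λ m₁ m₂ x e₁ e₂ y f₁ f₂ →
    x :* detᵖ (m₁ , m₂) (e₁ , e₂) :+ y :* detᵖ (m₁ , m₂) (f₁ , f₂)
      := detᵖ (m₁ , m₂) (x :* e₁ :+ y :* f₁ , x :* e₂ :+ y :* f₂))
    refl m₁ m₂ x e₁ e₂ y f₁ f₂

  det-comb-pos : ∀ m {x e y f} → 0# < x → 0# < y →
    (0# < det m e × 0# ≤ det m f) ⊎ (0# ≤ det m e × 0# < det m f) → 0# < det m (comb x e y f)
  det-comb-pos m 0<x 0<y (inj₁ (p , q)) = pos-resp (det-comb m _ _ _ _) (+-pos-0≤ (*-pos 0<x p) (*-pos-0≤ 0<y q))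
  det-comb-pos m 0<x 0<y (inj₂ (p , q)) = pos-resp (det-comb m _ _ _ _) (+-0≤-pos (*-pos-0≤ 0<x p) (*-pos 0<y q))

  det-comb-neg : ∀ m {x e y f} → 0# < x → 0# < y → 0# < det e m → 0# ≤ det f m → det m (comb x e y f) < 0#
  det-comb-neg m {x} {e} {y} {f} 0<x 0<y p q = pos⇒neg (pos-resp
    (trans (+-cong (*-congˡ (det-swap e m)) (*-congˡ (det-swap f m)))
      (trans (solve 4 (λ x y a b → x :* (:- a) :+ y :* (:- b) := :- (x :* a :+ y :* b))
          refl x y (det m e) (det m f))
        (-‿cong (det-comb m x e y f))))
    (+-pos-0≤ (*-pos 0<x p) (*-pos-0≤ 0<y q)))

  -- The Plücker relation of three plane vectors, solved for the side of the triangle that joins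
  -- pieces 1 and 2. This form serves ascending thresholds, and `close-triangleˡ` serves descending
  -- ones.
  close-triangleʳ : ∀ u v z → det u v ∙ z ≈₂ (det u z ∙ v − det v z ∙ u)
  close-triangleʳ (u₁ , u₂) (v₁ , v₂) (z₁ , z₂) =
    solve 6 (λ u₁ u₂ v₁ v₂ z₁ z₂ → let u = (u₁ , u₂) ; v = (v₁ , v₂) ; z = (z₁ , z₂) in
      detᵖ u v :* z₁ := detᵖ u z :* v₁ :- detᵖ v z :* u₁) refl u₁ u₂ v₁ v₂ z₁ z₂ ,
    solve 6 (λ u₁ u₂ v₁ v₂ z₁ z₂ → let u = (u₁ , u₂) ; v = (v₁ , v₂) ; z = (z₁ , z₂) in
      detᵖ u v :* z₂ := detᵖ u z :* v₂ :- detᵖ v z :* u₂) refl u₁ u₂ v₁ v₂ z₁ z₂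

  close-triangleˡ : ∀ u v z → det v z ∙ u ≈₂ (det u z ∙ v − det u v ∙ z)
  close-triangleˡ (u₁ , u₂) (v₁ , v₂) (z₁ , z₂) =
    solve 6 (λ u₁ u₂ v₁ v₂ z₁ z₂ → let u = (u₁ , u₂) ; v = (v₁ , v₂) ; z = (z₁ , z₂) in
      detᵖ v z :* u₁ := detᵖ u z :* v₁ :- detᵖ u v :* z₁) refl u₁ u₂ v₁ v₂ z₁ z₂ ,
    solve 6 (λ u₁ u₂ v₁ v₂ z₁ z₂ → let u = (u₁ , u₂) ; v = (v₁ , v₂) ; z = (z₁ , z₂) in
      detᵖ v z :* u₂ := detᵖ u z :* v₂ :- detᵖ u v :* z₂) refl u₁ u₂ v₁ v₂ z₁ z₂

  -- Coefficients of three rays in angular order inside one sector. They are needed because two or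
  -- three of the thresholds may coincide.
  weights : Fin 3 → Carrier × Carrier
  weights 0F = 2# , 1#
  weights 1F = 1# , 1#
  weights 2F = 1# , 2#

  weights-pos : ∀ i → 0# < proj₁ (weights i) × 0# < proj₂ (weights i)
  weights-pos 0F = 0<2 , 0<1
  weights-pos 1F = 0<1 , 0<1
  weights-pos 2F = 0<1 , 0<2

  weights-ordered : ∀ i k → i Fin.< k → 0# < det (weights i) (weights k)
  weights-ordered 0F 1F _ = pos-resp (solve 1 (λ o → o :* o := detᵖ (o :+ o , o) (o , o))
      refl 1#) (*-pos 0<1 0<1)
  weights-ordered 0F 2F _ = pos-resp
    (solve 1 (λ o → (o :* o :+ o :* o) :+ o :* o := detᵖ (o :+ o , o) (o , o :+ o)) refl 1#)
    (+-pos (+-pos (*-pos 0<1 0<1) (*-pos 0<1 0<1)) (*-pos 0<1 0<1))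
  weights-ordered 1F 2F _ = pos-resp (solve 1 (λ o → o :* o := detᵖ (o , o) (o , o :+ o))
      refl 1#) (*-pos 0<1 0<1)
  weights-ordered 1F 1F (s≤s ())
  weights-ordered 2F 1F (s≤s ())
  weights-ordered 2F 2F (s≤s (s≤s ()))

  triangle-config : ℝ² → ℝ² → Fin 3 → ℝ²
  triangle-config a d 0F = 0₂
  triangle-config a d 1F = a
  triangle-config a d 2F = d

  module _ {n} (μ : Fin (suc n) → ℝ²) where

    InSector : Fin (suc n) → ℝ² → Set ℓ₂
    InSector t v = ∀ j → HasSign (step t j) (det (μ j) v)

    sector-left : ∀ t v {j} → InSector t v → j Fin.≤ t → 0# < det (μ j) v
    sector-left t v {j} h j≤t = ≡.subst (λ s → HasSign s _) (step-≤ j≤t) (h j)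

    sector-right : ∀ t v {j} → InSector t v → t Fin.< j → det (μ j) v < 0#
    sector-right t v {j} h t<j = ≡.subst (λ s → HasSign s _) (step-> t<j) (h j)

    InSector-intro : ∀ {t v} → (∀ {j} → j Fin.≤ t → 0# < det (μ j) v) →
                     (∀ {j} → t Fin.< j → det (μ j) v < 0#) → InSector t v
    InSector-intro {t} lefts rights j with j Fin.≤? t
    ... | yes j≤t = ≡.subst (λ s → HasSign s _) (≡.sym (step-≤ j≤t)) (lefts j≤t)
    ... | no  j≰t = ≡.subst (λ s → HasSign s _) (≡.sym (step-> (ℕ.≰⇒> j≰t))) (rights (ℕ.≰⇒> j≰t))

    sector-scale : ∀ t v {k} → 0# < k → InSector t v → InSector t (k ∙ v)
    sector-scale t (v₁ , v₂) {k} 0<k h j = sign-resp (step t j)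
      (solve 5 (λ a b x y k → k :* detᵖ (a , b) (x , y) := detᵖ (a , b) (k :* x , k :* y))
        refl (proj₁ (μ j)) (proj₂ (μ j)) v₁ v₂ k)
      (sign-* (step t j) 0<k (h j))

    sector-resp : ∀ t {v w} → v ≈₂ w → InSector t v → InSector t w
    sector-resp t (e₁ , e₂) h j = sign-resp (step t j)
      (+-cong (*-congˡ e₂) (-‿cong (*-congˡ e₁))) (h j)

    triangle-Typed : ∀ x w y a d → InSector x a → InSector w d → InSector y (d − a) →
                     Typed μ (triangle-config a d) (standard (x , w , y))
    triangle-Typed x w y a@(a₁ , a₂) d@(d₁ , d₂) ha hd hda = typed
      where
      from-0 : ∀ m v → det m v ≈ det m (v − 0₂)
      from-0 (m₁ , m₂) (v₁ , v₂) = solve 4 (λ m₁ m₂ v₁ v₂ → detᵖ (m₁ , m₂) (v₁ , v₂)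
        := detᵖ (m₁ , m₂) (v₁ :- con (+ 0) , v₂ :- con (+ 0))) refl m₁ m₂ v₁ v₂
      to-0 : ∀ m v → - det m v ≈ det m (0₂ − v)
      to-0 (m₁ , m₂) (v₁ , v₂) = solve 4 (λ m₁ m₂ v₁ v₂ → :- detᵖ (m₁ , m₂) (v₁ , v₂)
        := detᵖ (m₁ , m₂) (con (+ 0) :- v₁ , con (+ 0) :- v₂)) refl m₁ m₂ v₁ v₂
      swap : ∀ m → - det m (d − a) ≈ det m (a − d)
      swap (m₁ , m₂) = solve 6 (λ m₁ m₂ a₁ a₂ d₁ d₂ →
        :- detᵖ (m₁ , m₂) (d₁ :- a₁ , d₂ :- a₂) := detᵖ (m₁ , m₂) (a₁ :- d₁ , a₂ :- d₂))
        refl m₁ m₂ a₁ a₂ d₁ d₂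
      typed : Typed μ (triangle-config a d) (standard (x , w , y))
      typed 0F j 0F i≢i = ⊥-elim (i≢i ≡.refl)
      typed 1F j 1F i≢i = ⊥-elim (i≢i ≡.refl)
      typed 2F j 2F i≢i = ⊥-elim (i≢i ≡.refl)
      typed 0F j 1F _ = sign-resp (step x j) (from-0 (μ j) a) (ha j)
      typed 0F j 2F _ = sign-resp (step w j) (from-0 (μ j) d) (hd j)
      typed 1F j 2F _ = hda j
      typed 1F j 0F _ = sign-resp (opposite (step x j)) (to-0 (μ j) a) (sign-neg (step x j) (ha j))
      typed 2F j 0F _ = sign-resp (opposite (step w j)) (to-0 (μ j) d) (sign-neg (step w j) (hd j))
      typed 2F j 1F _ = sign-resp (opposite (step y j)) (swap (μ j)) (sign-neg (step y j) (hda j))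

    SpansSector : Fin (suc n) → ℝ² → ℝ² → Set _
    SpansSector t e f = ∀ {x y} → 0# < x → 0# < y → InSector t (comb x e y f)

  ordered-≤ : ∀ {r} {μ : Fin r → ℝ²} → Ordered μ → ∀ {i j} → i Fin.≤ j → 0# ≤ det (μ i) (μ j)
  ordered-≤ {μ = μ} ordered {i} {j} i≤j with ℕ.m≤n⇒m<n∨m≡n i≤j
  ... | inj₁ i<j = pos⇒0≤ (ordered i<j)
  ... | inj₂ i≡j rewrite Fin.toℕ-injective i≡j = <-irrefl (det-self≈0 (μ j))

  -- The last sector ends at the reverse of the first move. With a single move it is a half plane,
  -- and that reverse would be antiparallel to the other edge; the move turned by a right angle is
  -- taken instead.
  last-edge : ∀ {n} (μ : Fin (suc n) → ℝ²) (ordered : Ordered μ) (nonzero : ¬ μ zero ≈₂ 0₂) →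
    ∃ λ f → 0# < det (μ (Fin.fromℕ n)) f × SpansSector μ (Fin.fromℕ n) (μ (Fin.fromℕ n)) f
  last-edge {zero} μ ordered nonzero = (- b , a) , perp-pos , λ 0<x 0<y → λ where
      zero → det-comb-pos (μ zero) 0<x 0<y (inj₂ (<-irrefl (det-self≈0 (μ zero)) , perp-pos))
    where
    a = proj₁ (μ zero)
    b = proj₂ (μ zero)
    perp≈ : a * a + b * b ≈ det (μ zero) (- b , a)
    perp≈ = solve 2 (λ a b → a :* a :+ b :* b := detᵖ (a , b) (:- b , a)) refl a b
    perp-pos : 0# < det (μ zero) (- b , a)
    perp-pos with compare 0# a
    ... | tri< 0<a _ _ = pos-resp perp≈ (+-pos-0≤ (*-pos 0<a 0<a) (square-0≤ b))
    ... | tri> _ _ a<0 = pos-resp perp≈ (+-pos-0≤ (square-pos (λ a≈0 → <-irrefl a≈0 a<0)) (square-0≤ b))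
    ... | tri≈ _ 0≈a _ = pos-resp perp≈ (+-0≤-pos (square-0≤ a) (square-pos (λ b≈0 → nonzero (sym 0≈a , b≈0))))
  last-edge {suc n} μ ordered nonzero = -₂ μ zero ,
      pos-resp (det-neg-swap (μ zero) (μ (Fin.fromℕ (suc n)))) (ordered (s≤s z≤n)) ,
      λ 0<x 0<y → InSector-intro μ (lefts 0<x 0<y)
        (λ {j} last<j → ⊥-elim (ℕ.<⇒≱ last<j (Fin.≤fromℕ j)))
    where
    det-neg-swap : ∀ u v → det u v ≈ det v (-₂ u)
    det-neg-swap (a , b) (x , y) = solve 4 (λ a b x y → detᵖ (a , b) (x , y) := detᵖ (x , y) (:- a , :- b))
        refl a b x y
    lefts : ∀ {x y} → 0# < x → 0# < y → ∀ {j} → j Fin.≤ Fin.fromℕ (suc n) →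
      0# < det (μ j) (comb x (μ (Fin.fromℕ (suc n))) y (-₂ μ zero))
    lefts 0<x 0<y {zero} _ = det-comb-pos (μ zero) 0<x 0<y
      (inj₁ (ordered (s≤s z≤n) , <-irrefl (trans (sym (det-neg-swap (μ zero) (μ zero))) (det-self≈0 (μ zero)))))
    lefts 0<x 0<y {suc j} j≤ = det-comb-pos (μ (suc j)) 0<x 0<y
      (inj₂ (ordered-≤ ordered j≤ , pos-resp (det-neg-swap (μ zero) (μ (suc j))) (ordered (s≤s z≤n))))

  module _ {n} (μ : Fin (suc n) → ℝ²) (ordered : Ordered μ) (nonzero : ¬ μ zero ≈₂ 0₂) where

    -- Both vectors lie to the left of the first move, and the move `t` separates them. The Plücker
    -- relation for these two moves and `u`, `v` turns the known signs into the sign of `det u v`.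
    sectors-ordered : ∀ s t u v → s Fin.< t → InSector μ s u → InSector μ t v → 0# < det u v
    sectors-ordered s t u@(u₁ , u₂) v@(v₁ , v₂) s<t hu hv = *-cancelˡ-pos
      (ordered (ℕ.≤-<-trans z≤n s<t))
      (pos-resp (solve 8 (λ a₁ a₂ b₁ b₂ u₁ u₂ v₁ v₂ →
          let a = (a₁ , a₂) ; b = (b₁ , b₂) ; u = (u₁ , u₂) ; v = (v₁ , v₂) in
          detᵖ a u :* detᵖ b v :+ detᵖ a v :* (:- detᵖ b u) := detᵖ a b :* detᵖ u v)
          refl (proj₁ (μ zero)) (proj₂ (μ zero)) (proj₁ (μ t)) (proj₂ (μ t)) u₁ u₂ v₁ v₂)
        (+-pos (*-pos (sector-left μ s u hu z≤n) (sector-left μ t v hv ℕ.≤-refl))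
               (*-pos (sector-left μ t v hv z≤n) (neg⇒pos (sector-right μ s u hu s<t)))))

    -- Left of the moves up to `t` and right of the later ones means between `μ t` and the next
    -- move; the last sector has no next move and is left to `last-edge`.
    edges : ∀ t → ∃ λ e → ∃ λ f → 0# < det e f × SpansSector μ t e f
    edges t with view t
    ... | ‵fromℕ = let f , 0<ef , spans = last-edge μ ordered nonzero in μ (Fin.fromℕ _) , f , 0<ef , spans
    ... | ‵inj₁ {i = i} _ = μ (inject₁ i) , μ (suc i) , ordered (s≤s (ℕ.≤-reflexive (Fin.toℕ-inject₁ i))) ,
      λ 0<x 0<y → InSector-intro μ
        (λ {j} j≤i → det-comb-pos (μ j) 0<x 0<y
          (inj₂ (ordered-≤ ordered j≤i , ordered (s≤s (ℕ.≤-trans j≤i (ℕ.≤-reflexive (Fin.toℕ-inject₁ i)))))))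
        (λ {j} i<j → det-comb-neg (μ j) 0<x 0<y (ordered i<j)
          (ordered-≤ ordered (ℕ.≤-trans (s≤s (ℕ.≤-reflexive (≡.sym (Fin.toℕ-inject₁ i)))) i<j)))

    ray : Fin (suc n) → Fin 3 → ℝ²
    ray t i = let e , f , _ = edges t ; x , y = weights i in comb x e y f

    ray-InSector : ∀ t i → InSector μ t (ray t i)
    ray-InSector t i = let _ , _ , _ , spans = edges t ; 0<x , 0<y = weights-pos i in spans 0<x 0<y

    -- Rays of different sectors are ordered as the sectors are. Within one sector, the determinant
    -- of two rays is the determinant of their weights times that of the edges.
    rays-ordered : ∀ s i t k → s Fin.≤ t → i Fin.< k → 0# < det (ray s i) (ray t k)
    rays-ordered s i t k s≤t i<k with ℕ.m≤n⇒m<n∨m≡n s≤t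
    ... | inj₁ s<t = sectors-ordered s t (ray s i) (ray t k) s<t (ray-InSector s i) (ray-InSector t k)
    ... | inj₂ s≡t rewrite Fin.toℕ-injective s≡t = let (e₁ , e₂) , (f₁ , f₂) , 0<ef , _ = edges t in pos-resp
      (solve 8 (λ x y x′ y′ e₁ e₂ f₁ f₂ → detᵖ (x , y) (x′ , y′) :* detᵖ (e₁ , e₂) (f₁ , f₂)
          := detᵖ (x :* e₁ :+ y :* f₁ , x :* e₂ :+ y :* f₂) (x′ :* e₁ :+ y′ :* f₁ , x′ :* e₂ :+ y′ :* f₂))
        refl (proj₁ (weights i)) (proj₂ (weights i)) (proj₁ (weights k)) (proj₂ (weights k)) e₁ e₂ f₁ f₂)
      (*-pos (weights-ordered i k i<k) 0<ef)

    -- The Plücker relation det u z ∙ v = det v z ∙ u + det u v ∙ z closes up a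
    -- triangle whose sides point along rays in the three required sectors.
    standard-realised : ∀ {t} → Between t → ∃ λ q → Typed μ q (standard t)
    standard-realised {x , w , y} (inj₁ (x≤w , w≤y)) = _ ,
      triangle-Typed μ x w y (det v z ∙ u) (det u z ∙ v)
        (sector-scale μ x u (rays-ordered w 1F y 2F w≤y (s≤s (s≤s z≤n))) (ray-InSector x 0F))
        (sector-scale μ w v (rays-ordered x 0F y 2F (ℕ.≤-trans x≤w w≤y) (s≤s z≤n)) (ray-InSector w 1F))
        (sector-resp μ y (close-triangleʳ u v z)
          (sector-scale μ y z (rays-ordered x 0F w 1F x≤w (s≤s z≤n)) (ray-InSector y 2F)))
      where
      u = ray x 0F
      v = ray w 1F
      z = ray y 2F
    standard-realised {x , w , y} (inj₂ (y≤w , w≤x)) = _ ,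
      triangle-Typed μ x w y (det u v ∙ z) (det u z ∙ v)
        (sector-scale μ x z (rays-ordered y 0F w 1F y≤w (s≤s z≤n)) (ray-InSector x 2F))
        (sector-scale μ w v (rays-ordered y 0F x 2F (ℕ.≤-trans y≤w w≤x) (s≤s z≤n)) (ray-InSector w 1F))
        (sector-resp μ y (close-triangleˡ u v z)
          (sector-scale μ y u (rays-ordered w 1F x 2F w≤x (s≤s (s≤s z≤n))) (ray-InSector y 0F)))
      where
      u = ray y 0F
      v = ray w 1F
      z = ray x 2F

-- Orienting the moves by slope, and the types that occur

module Orientation {c ℓ₁ ℓ₂} (ℝ : CompleteOrderedField c ℓ₁ ℓ₂) where
  open CompleteOrderedField ℝ hiding (zero)
  open OrderedField ℝ
  open Counting
  open TypesOfThree
  open IntegerRingSolver commutativeRing using (con)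
  open Realisation ℝ
  open Sectors ℝ
  open Plane ℝ
  open AddSupremum _<_ using (_<⁺_; [_])

  quotient-* : ∀ x y x≉0 → y ≈ y * proj₁ (inverse x x≉0) * x
  quotient-* x y x≉0 = sym (trans (*-assoc _ _ _)
    (trans (*-congˡ (trans (*-comm _ _) (proj₂ (inverse x x≉0)))) (*-identityʳ y)))

  slope-view : ∀ m → (∃ λ s → slope m ≡ [ s ] × proj₂ m ≈ s * proj₁ m × ¬ proj₁ m ≈ 0#)
                   ⊎ (slope m ≡ ⊤⁺ × proj₁ m ≈ 0#)
  slope-view (x , y) with compare x 0#
  ... | tri< _ x≉0 _ = inj₁ (_ , ≡.refl , quotient-* x y x≉0 , x≉0)
  ... | tri≈ _ x≈0 _ = inj₂ (≡.refl , x≈0)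
  ... | tri> _ x≉0 _ = inj₁ (_ , ≡.refl , quotient-* x y x≉0 , x≉0)

  -- The right half plane together with the upper half of the vertical axis. It contains one of the
  -- two directions of every line through the origin, and in it angular order is the order of
  -- slopes.
  data Positive (v : ℝ²) : Carrier ⁺ → Set (c ⊔ ℓ₁ ⊔ ℓ₂) where
    rightward : ∀ {s} → 0# < proj₁ v → proj₂ v ≈ s * proj₁ v → Positive v [ s ]
    upward    : proj₁ v ≈ 0# → 0# < proj₂ v → Positive v ⊤⁺

  -- For finite slopes the determinant is `t - s` times the product of the two positive first
  -- coordinates.
  positive-det : ∀ {u v s t} → Positive u s → Positive v t → s <⁺ t → 0# < det u v
  positive-det {u₁ , u₂} {v₁ , v₂} (rightward {s} 0<u₁ u₂≈) (rightward {t} 0<v₁ v₂≈) [ s<t ] = pos-resp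
    (trans (solve 4 (λ s t x y → (t :- s) :* (x :* y) := x :* (t :* y) :- (s :* x) :* y)
        refl s t u₁ v₁)
      (+-cong (*-congˡ (sym v₂≈)) (-‿cong (*-congʳ (sym u₂≈)))))
    (*-pos (<⇒pos s<t) (*-pos 0<u₁ 0<v₁))
  positive-det {u₁ , u₂} {v₁ , v₂} (rightward 0<u₁ _) (upward v₁≈0 0<v₂) _ = pos-resp
    (sym (trans (+-congˡ (-‿cong (*-congˡ v₁≈0)))
      (solve 3 (λ x y z → x :* y :- z :* con (ℤ.+ 0) := x :* y) refl u₁ v₂ u₂)))
    (*-pos 0<u₁ 0<v₂)

  -- Reversing a vector keeps its slope, so the index is still the slope of the original `m` and the
  -- given order of the moves carries over.
  orient : ∀ m → ¬ m ≈₂ 0₂ → ∃ λ b → Positive (signed b m) (slope m)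
  orient m@(x , y) m≉0 with slope-view m
  ... | inj₁ (s , slope≡ , y≈sx , x≉0) rewrite slope≡ with compare 0# x
  ...   | tri< 0<x _ _ = false , rightward 0<x y≈sx
  ...   | tri≈ _ 0≈x _ = ⊥-elim (x≉0 (sym 0≈x))
  ...   | tri> _ _ x<0 = true , rightward (neg⇒pos x<0)
            (trans (-‿cong y≈sx) (solve 2 (λ s x → :- (s :* x) := s :* (:- x)) refl s x))
  orient m@(x , y) m≉0 | inj₂ (slope≡ , x≈0) rewrite slope≡ with compare 0# y
  ...   | tri< 0<y _ _ = false , upward x≈0 0<y
  ...   | tri≈ _ 0≈y _ = ⊥-elim (m≉0 (x≈0 , sym 0≈y))
  ...   | tri> _ _ y<0 = true , upward
            (trans (-‿cong x≈0) (solve 0 (:- con (ℤ.+ 0) := con (ℤ.+ 0)) refl)) (neg⇒pos y<0)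

  module _ {r} (P : Rider r) where
    open Rider P

    flipped : Fin r → Bool
    flipped j = proj₁ (orient (move j) (nonzero j))

    oriented : Fin r → ℝ²
    oriented j = signed (flipped j) (move j)

    oriented-Positive : ∀ j → Positive (oriented j) (slope (move j))
    oriented-Positive j = proj₂ (orient (move j) (nonzero j))

    oriented-Ordered : Ordered oriented
    oriented-Ordered {i} {j} i<j = positive-det (oriented-Positive i) (oriented-Positive j) (increasing i j i<j)

    oriented-nonzero : ∀ j → ¬ oriented j ≈₂ 0₂
    oriented-nonzero j (x≈0 , y≈0) with slope (move j) | oriented-Positive j
    ... | _ | rightward 0<x _ = pos⇒≉0 0<x x≈0
    ... | _ | upward _ 0<y    = pos⇒≉0 0<y y≈0

  module _ {n} (P : Rider (suc n)) (B : Board) where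
    open Rider P

    o = flipped P
    μ = oriented P

    Types⇒Admissible : ∀ T → Types P 3 B T → Admissible (flips o T)
    Types⇒Admissible T (_ , _ , z , _ , _ , hasType) = Typed⇒Admissible μ (oriented-Ordered P) {z = fromℤ² ∘ z}
      λ i j k i≢k → sign-flip (o j) (T i j k i≢k) (move j) _
        (OnSide⇒sign P (T i j k i≢k) (move j) _ (hasType i j k i≢k))

    -- Occurrence among points of the real plane, with the moves already oriented; the passage to
    -- lattice points of the board is `HasType⇒Types`.
    Realisable : LabelledType 3 (suc n) → Set _
    Realisable T = ∃ λ q → Typed μ q T

    Realisable⇒Types : ∀ T → Realisable (flips o T) → Types P 3 B T
    Realisable⇒Types T (q , typed) = HasType⇒Types P B q T λ i j k i≢k →
      sign⇒OnSide P (T i j k i≢k) (move j) (q k − q i)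
        (sign-unflip (o j) (T i j k i≢k) (move j) (q k − q i) (typed i j k i≢k))

    Realisable-∼ : ∀ T U → T ∼ U → Realisable T → Realisable U
    Realisable-∼ T U (π , U≐πT) (q , typed) = q ∘ (π ⟨$⟩ʳ_) , λ i j k i≢k →
      ≡.subst (λ s → HasSign s (det (μ j) (q (π ⟨$⟩ʳ k) − q (π ⟨$⟩ʳ i)))) (≡.sym (U≐πT i j k i≢k))
        (typed (π ⟨$⟩ʳ i) j (π ⟨$⟩ʳ k) (i≢k ∘ Injection.injective (↔⇒↣ π)))

    standard-Realisable : ∀ t → Between t → Realisable (standard t)
    standard-Realisable t = standard-realised μ (oriented-Ordered P) (oriented-nonzero P zero)

    Admissible⇒Realisable : ∀ T → Admissible T → Realisable T
    Admissible⇒Realisable T A = let t , t-between , T∼t = Admissible⇒standard A in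
      Realisable-∼ (standard t) T (∼-sym T (standard t) T∼t) (standard-Realisable t t-between)

    Admissible⇒Types : ∀ T → Admissible (flips o T) → Types P 3 B T
    Admissible⇒Types T A = Realisable⇒Types T (Admissible⇒Realisable (flips o T) A)

    standard-Types : ∀ t → Between t → Types P 3 B (flips o (standard t))
    standard-Types t t-between = Realisable⇒Types (flips o (standard t))
      (Realisable-∼ (standard t) (flips o (flips o (standard t)))
        (≐⇒∼ (≐-sym (flips-self o (standard t)))) (standard-Realisable t t-between))

    Types⇔Admissible : ∀ T → Types P 3 B T ⇔ Admissible (flips o T)
    Types⇔Admissible T = mk⇔ (Types⇒Admissible T) (Admissible⇒Types T)

    cardinality : HasCardinality (unlabelled (Types P 3 B)) (count (suc n))
    cardinality = Admissible-cardinality o (Types P 3 B) Types⇒Admissible standard-Types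

  equalUpToReorientation : ∀ {n} (P P′ : Rider (suc n)) (B B′ : Board) →
                           EqualUpToReorientation (Types P 3 B) (Types P′ 3 B′)
  equalUpToReorientation P P′ B B′ = Admissible-EqualUpToReorientation (flipped P) (flipped P′)
    (Types P 3 B) (Types P′ 3 B′) (Types⇔Admissible P B) (Types⇔Admissible P′ B′)

open import Data.Nat using (_+_; _*_; _^_; _∸_; _≤_)

theorem3p2 : ∀ {c ℓ₁ ℓ₂} (ℝ : CompleteOrderedField c ℓ₁ ℓ₂) (r : ℕ) → 1 ≤ r →
    let open Plane ℝ in
    (∀ (B : Board) (P : Rider r) →
    ∃ λ N → 3 * N ≡ r * (r ^ 2 + 3 * r ∸ 1) × HasCardinality (unlabelled (Types P 3 B)) N)
    ×
    (∀ (P P′ : Rider r) (B B′ : Board) →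
    EqualUpToReorientation (Types P 3 B) (Types P′ 3 B′))
theorem3p2 ℝ r@(suc n) 1≤r =
  (λ B P → Counting.count r , Counting.3*count r 1≤r , Orientation.cardinality ℝ P B) ,
  Orientation.equalUpToReorientation ℝ
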